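{- Let $(\mathbb X,\otimes,K)$ be a linear category with monoidal coalgebra modality $(!,\delta,\varepsilon,\Delta,\mathsf e,\mathsf m,\mathsf m_K)$ which is also an additive symmetric monoidal category with negatives. For each object $A$ let $\nabla_A=!\big(\rho_A\circ(\varepsilon_A\otimes\mathsf e_A)+\ell_A\circ(\mathsf e_A\otimes\varepsilon_A)\big)\circ\mathsf m_{!A,!A}\circ(\delta_A\otimes\delta_A)$ and $\mathsf u_A=!(0_{K,A})\circ\mathsf m_K$. Then for every object $A$, $(!A\otimes-,\mu,\eta,\mathsf n,\mathsf n_K,\lambda)$ is a $\mathsf{MELL}$ lifting monad, where $\mu_X=(\nabla_A\otimes1_X)\circ\alpha_{!A,!A,X}$, $\eta_X=(\mathsf u_A\otimes1_X)\circ\ell_X^{ -1}$, $\mathsf n_{X,Y}=\tau_{!A,!A,X,Y}\circ(\Delta_A\otimes1_{X\otimes Y})$, $\mathsf n_K=\mathsf e_A\circ\rho_{!A}$, $\lambda_X=\mathsf m_{!A,X}\circ(\delta_A\otimes1_{!X})$; consequently the category $\mathsf{MOD}(!A,\nabla_A,\mathsf u_A)$ of left $(!A,\nabla_A,\mathsf u_A)$-modules, with tensor $(M,a)\otimes(N,b)=(M\otimes N,(a\otimes b)\circ\mathsf n_{M,N})$ and unit $(K,\mathsf n_K)$, is a linear category.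
   Context: Composition is written $g\circ f$; $(\mathbb X,\otimes,K)$ is symmetric monoidal with associator $\alpha_{A,B,C}:A\otimes(B\otimes C)\to(A\otimes B)\otimes C$, unitors $\ell_A:K\otimes A\to A$, $\rho_A:A\otimes K\to A$, symmetry $\sigma$, interchange iso $\tau_{A,B,C,D}:(A\otimes B)\otimes(C\otimes D)\to(A\otimes C)\otimes(B\otimes D)$. Additive symmetric monoidal category: hom-sets are commutative monoids (sum $+$, zero $0$), composition and $\otimes$ preserve sums and zeros in each argument; it has negatives if every map has an additive inverse. Monoidal coalgebra modality: comonad $(!,\delta,\varepsilon)$ with lax symmetric monoidal structure $\mathsf m_{A,B}:!A\otimes!B\to!(A\otimes B)$, $\mathsf m_K:K\to!K$ making $\delta,\varepsilon$ monoidal, and natural $\Delta_A:!A\to!A\otimes!A$, $\mathsf e_A:!A\to K$ making each $!A$ a cocommutative comonoid with $\delta_A$ a comonoid morphism, such that $\Delta_{A\otimes B}\circ\mathsf m_{A,B}=(\mathsf m_{A,B}\otimes\mathsf m_{A,B})\circ\tau\circ(\Delta_A\otimes\Delta_B)$, $\mathsf e_{A\otimes B}\circ\mathsf m_{A,B}=\ell_K\circ(\mathsf e_A\otimes\mathsf e_B)$, $\Delta_K\circ\mathsf m_K=(\mathsf m_K\otimes\mathsf m_K)\circ\ell_K^{ -1}$, $\mathsf e_K\circ\mathsf m_K=1_K$, $!(\Delta_A)\circ\delta_A=\mathsf m_{!A,!A}\circ(\delta_A\otimes\delta_A)\circ\Delta_A$, $!(\mathsf e_A)\circ\delta_A=\mathsf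 m_K\circ\mathsf e_A$. A linear category is a symmetric monoidal closed category with a monoidal coalgebra modality. Symmetric comonoidal monad: monad $(\mathsf T,\mu,\eta)$ with natural $\mathsf n_{B,C}:\mathsf T(B\otimes C)\to\mathsf TB\otimes\mathsf TC$, $\mathsf n_K:\mathsf TK\to K$ making $\mathsf T$ symmetric comonoidal and $\mu,\eta$ comonoidal; it is a symmetric Hopf monad if $(1\otimes\mu_C)\circ\mathsf n_{B,\mathsf TC}$ and $(\mu_B\otimes1)\circ\mathsf n_{\mathsf TB,C}$ are isomorphisms. A $\mathsf{MELL}$ lifting monad on a linear category is a symmetric Hopf monad together with a natural $\lambda_B:\mathsf T!B\to!\mathsf TB$ such that $\lambda_B\circ\mu_{!B}=!(\mu_B)\circ\lambda_{\mathsf TB}\circ\mathsf T(\lambda_B)$, $\lambda_B\circ\eta_{!B}=!(\eta_B)$, $\delta_{\mathsf TB}\circ\lambda_B=!(\lambda_B)\circ\lambda_{!B}\circ\mathsf T(\delta_B)$, $\varepsilon_{\mathsf TB}\circ\lambda_B=\mathsf T(\varepsilon_B)$, $!(\mathsf n_{B,C})\circ\lambda_{B\otimes C}\circ\mathsf T(\mathsf m_{B,C})=\mathsf m_{\mathsf TB,\mathsf TC}\circ(\lambda_B\otimes\lambda_C)\circ\mathsf n_{!B,!C}$, $!(\mathsf n_K)\circ\lambda_K\circ\mathsf T(\mathsf m_K)=\mathsf m_K\circ\mathsf n_K$. -}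

module Defs where

open import Level using (Level; _⊔_) renaming (suc to lsuc)
open import Relation.Binary.Core using (Rel)
open import Relation.Binary.Structures using (IsEquivalence)
open import Relation.Binary.Bundles using (Setoid)
open import Relation.Binary.PropositionalEquality using (_≡_; refl)
open import Data.Product using (Σ; _×_; _,_; ∃)
import Relation.Binary.Reasoning.Setoid as SetoidR

record Category (o h ℓe : Level) : Set (lsuc (o ⊔ h ⊔ ℓe)) where
  infix  4 _≈_
  infixr 9 _∘_
  field
    Obj   : Set o
    _⇒_   : Obj → Obj → Set h
    _≈_   : ∀ {A B} → Rel (A ⇒ B) ℓe
    id    : ∀ {A} → A ⇒ A
    _∘_   : ∀ {A B C} → B ⇒ C → A ⇒ B → A ⇒ C
    equiv : ∀ {A B} → IsEquivalence (_≈_ {A} {B})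
    assoc : ∀ {A B C D} {f : A ⇒ B} {g : B ⇒ C} {k : C ⇒ D} →
            (k ∘ g) ∘ f ≈ k ∘ (g ∘ f)
    identityˡ : ∀ {A B} {f : A ⇒ B} → id ∘ f ≈ f
    identityʳ : ∀ {A B} {f : A ⇒ B} → f ∘ id ≈ f
    ∘-resp-≈  : ∀ {A B C} {f f′ : B ⇒ C} {g g′ : A ⇒ B} →
                f ≈ f′ → g ≈ g′ → f ∘ g ≈ f′ ∘ g′

  hom-setoid : Obj → Obj → Setoid h ℓe
  hom-setoid A B = record { Carrier = A ⇒ B ; _≈_ = _≈_ ; isEquivalence = equiv }

  record IsIso {A B : Obj} (f : A ⇒ B) : Set (h ⊔ ℓe) where
    field
      inv  : B ⇒ A
      isoˡ : inv ∘ f ≈ id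
      isoʳ : f ∘ inv ≈ id

record SymmetricMonoidal {o h ℓe} (C : Category o h ℓe) : Set (o ⊔ h ⊔ ℓe) where
  open Category C
  infixr 10 _⊗₀_ _⊗₁_
  field
    _⊗₀_ : Obj → Obj → Obj
    _⊗₁_ : ∀ {A B C D} → A ⇒ B → C ⇒ D → (A ⊗₀ C) ⇒ (B ⊗₀ D)
    ⊗-id : ∀ {A B} → id {A} ⊗₁ id {B} ≈ id
    ⊗-∘  : ∀ {A B C D E F} {f : B ⇒ C} {g : A ⇒ B} {k : E ⇒ F} {l : D ⇒ E} →
           (f ∘ g) ⊗₁ (k ∘ l) ≈ (f ⊗₁ k) ∘ (g ⊗₁ l)
    ⊗-resp-≈ : ∀ {A B C D} {f f′ : A ⇒ B} {g g′ : C ⇒ D} →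
               f ≈ f′ → g ≈ g′ → f ⊗₁ g ≈ f′ ⊗₁ g′
    K : Obj
    α⇒ : ∀ {A B C} → (A ⊗₀ (B ⊗₀ C)) ⇒ ((A ⊗₀ B) ⊗₀ C)
    α⇐ : ∀ {A B C} → ((A ⊗₀ B) ⊗₀ C) ⇒ (A ⊗₀ (B ⊗₀ C))
    α-isoˡ : ∀ {A B C} → α⇐ ∘ α⇒ {A} {B} {C} ≈ id
    α-isoʳ : ∀ {A B C} → α⇒ ∘ α⇐ {A} {B} {C} ≈ id
    α-natural : ∀ {A B C D E F} {f : A ⇒ D} {g : B ⇒ E} {k : C ⇒ F} →
                α⇒ ∘ (f ⊗₁ (g ⊗₁ k)) ≈ ((f ⊗₁ g) ⊗₁ k) ∘ α⇒
    ℓ⇒ : ∀ {A} → (K ⊗₀ A) ⇒ A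
    ℓ⇐ : ∀ {A} → A ⇒ (K ⊗₀ A)
    ℓ-isoˡ : ∀ {A} → ℓ⇐ ∘ ℓ⇒ {A} ≈ id
    ℓ-isoʳ : ∀ {A} → ℓ⇒ ∘ ℓ⇐ {A} ≈ id
    ℓ-natural : ∀ {A B} {f : A ⇒ B} → ℓ⇒ ∘ (id ⊗₁ f) ≈ f ∘ ℓ⇒
    ρ⇒ : ∀ {A} → (A ⊗₀ K) ⇒ A
    ρ⇐ : ∀ {A} → A ⇒ (A ⊗₀ K)
    ρ-isoˡ : ∀ {A} → ρ⇐ ∘ ρ⇒ {A} ≈ id
    ρ-isoʳ : ∀ {A} → ρ⇒ ∘ ρ⇐ {A} ≈ id
    ρ-natural : ∀ {A B} {f : A ⇒ B} → ρ⇒ ∘ (f ⊗₁ id) ≈ f ∘ ρ⇒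
    σ : ∀ {A B} → (A ⊗₀ B) ⇒ (B ⊗₀ A)
    σ-natural : ∀ {A B C D} {f : A ⇒ B} {g : C ⇒ D} →
                σ ∘ (f ⊗₁ g) ≈ (g ⊗₁ f) ∘ σ
    σ-involutive : ∀ {A B} → σ {B} {A} ∘ σ {A} {B} ≈ id
    pentagon : ∀ {A B C D} →
      α⇒ {A ⊗₀ B} {C} {D} ∘ α⇒ {A} {B} {C ⊗₀ D}
        ≈ (α⇒ {A} {B} {C} ⊗₁ id) ∘ (α⇒ {A} {B ⊗₀ C} {D} ∘ (id ⊗₁ α⇒ {B} {C} {D}))
    triangle : ∀ {A B} → (ρ⇒ {A} ⊗₁ id {B}) ∘ α⇒ ≈ id ⊗₁ ℓ⇒
    hexagon : ∀ {A B C} →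
      α⇒ {C} {A} {B} ∘ (σ {A ⊗₀ B} {C} ∘ α⇒ {A} {B} {C})
        ≈ (σ {A} {C} ⊗₁ id) ∘ (α⇒ {A} {C} {B} ∘ (id ⊗₁ σ {B} {C}))

  τ : ∀ {A B C D} → ((A ⊗₀ B) ⊗₀ (C ⊗₀ D)) ⇒ ((A ⊗₀ C) ⊗₀ (B ⊗₀ D))
  τ {A} {B} {C} {D} =
    α⇒ {A} {C} {B ⊗₀ D}
    ∘ ((id ⊗₁ α⇐ {C} {B} {D})
    ∘ ((id ⊗₁ (σ {B} {C} ⊗₁ id))
    ∘ ((id ⊗₁ α⇒ {B} {C} {D})
    ∘ α⇐ {A} {B} {C ⊗₀ D})))

record Closed {o h ℓe} {C : Category o h ℓe} (M : SymmetricMonoidal C) : Set (o ⊔ h ⊔ ℓe) where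
  open Category C
  open SymmetricMonoidal M
  field
    [_,_]₀ : Obj → Obj → Obj
    ev     : ∀ {A B} → ([ A , B ]₀ ⊗₀ A) ⇒ B
    curry  : ∀ {A B X} → (X ⊗₀ A) ⇒ B → X ⇒ [ A , B ]₀
    curry-β : ∀ {A B X} {f : (X ⊗₀ A) ⇒ B} → ev ∘ (curry f ⊗₁ id) ≈ f
    curry-unique : ∀ {A B X} {f : (X ⊗₀ A) ⇒ B} {g : X ⇒ [ A , B ]₀} →
                   ev ∘ (g ⊗₁ id) ≈ f → g ≈ curry f

record MonoidalCoalgebraModality {o h ℓe} {C : Category o h ℓe}
         (M : SymmetricMonoidal C) : Set (o ⊔ h ⊔ ℓe) where
  open Category C
  open SymmetricMonoidal M
  field
    !₀ : Obj → Obj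
    !₁ : ∀ {A B} → A ⇒ B → !₀ A ⇒ !₀ B
    !-id : ∀ {A} → !₁ (id {A}) ≈ id
    !-∘  : ∀ {A B C} {f : B ⇒ C} {g : A ⇒ B} → !₁ (f ∘ g) ≈ !₁ f ∘ !₁ g
    !-resp-≈ : ∀ {A B} {f g : A ⇒ B} → f ≈ g → !₁ f ≈ !₁ g
    δ : ∀ {A} → !₀ A ⇒ !₀ (!₀ A)
    ε : ∀ {A} → !₀ A ⇒ A
    δ-natural : ∀ {A B} {f : A ⇒ B} → !₁ (!₁ f) ∘ δ ≈ δ ∘ !₁ f
    ε-natural : ∀ {A B} {f : A ⇒ B} → f ∘ ε ≈ ε ∘ !₁ f
    comonad-assoc : ∀ {A} → δ { !₀ A} ∘ δ {A} ≈ !₁ (δ {A}) ∘ δ {A}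
    comonad-idˡ   : ∀ {A} → ε { !₀ A} ∘ δ {A} ≈ id
    comonad-idʳ   : ∀ {A} → !₁ (ε {A}) ∘ δ {A} ≈ id
    m  : ∀ {A B} → (!₀ A ⊗₀ !₀ B) ⇒ !₀ (A ⊗₀ B)
    mK : K ⇒ !₀ K
    m-natural : ∀ {A B C D} {f : A ⇒ B} {g : C ⇒ D} →
                m ∘ (!₁ f ⊗₁ !₁ g) ≈ !₁ (f ⊗₁ g) ∘ m
    m-assoc : ∀ {A B C} →
      m {A ⊗₀ B} {C} ∘ ((m {A} {B} ⊗₁ id) ∘ α⇒)
        ≈ !₁ α⇒ ∘ (m {A} {B ⊗₀ C} ∘ (id ⊗₁ m {B} {C}))
    m-unitˡ : ∀ {A} → !₁ (ℓ⇒ {A}) ∘ (m {K} {A} ∘ (mK ⊗₁ id)) ≈ ℓ⇒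
    m-unitʳ : ∀ {A} → !₁ (ρ⇒ {A}) ∘ (m {A} {K} ∘ (id ⊗₁ mK)) ≈ ρ⇒
    m-symmetric : ∀ {A B} → m {B} {A} ∘ σ ≈ !₁ σ ∘ m {A} {B}
    δ-m  : ∀ {A B} → δ ∘ m {A} {B} ≈ !₁ m ∘ (m { !₀ A} { !₀ B} ∘ (δ ⊗₁ δ))
    δ-mK : δ ∘ mK ≈ !₁ mK ∘ mK
    ε-m  : ∀ {A B} → ε ∘ m {A} {B} ≈ ε ⊗₁ ε
    ε-mK : ε ∘ mK ≈ id
    Δ : ∀ {A} → !₀ A ⇒ (!₀ A ⊗₀ !₀ A)
    e : ∀ {A} → !₀ A ⇒ K
    Δ-natural : ∀ {A B} {f : A ⇒ B} → (!₁ f ⊗₁ !₁ f) ∘ Δ ≈ Δ ∘ !₁ f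
    e-natural : ∀ {A B} {f : A ⇒ B} → e ∘ !₁ f ≈ e
    Δ-coassoc : ∀ {A} → α⇒ ∘ ((id ⊗₁ Δ) ∘ Δ {A}) ≈ (Δ ⊗₁ id) ∘ Δ {A}
    Δ-counitˡ : ∀ {A} → ℓ⇒ ∘ ((e ⊗₁ id) ∘ Δ {A}) ≈ id
    Δ-counitʳ : ∀ {A} → ρ⇒ ∘ ((id ⊗₁ e) ∘ Δ {A}) ≈ id
    Δ-cocomm  : ∀ {A} → σ ∘ Δ {A} ≈ Δ
    δ-Δ : ∀ {A} → Δ ∘ δ {A} ≈ (δ ⊗₁ δ) ∘ Δ
    δ-e : ∀ {A} → e ∘ δ {A} ≈ e
    Δ-m  : ∀ {A B} → Δ ∘ m {A} {B} ≈ (m ⊗₁ m) ∘ (τ ∘ (Δ ⊗₁ Δ))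
    e-m  : ∀ {A B} → e ∘ m {A} {B} ≈ ℓ⇒ ∘ (e ⊗₁ e)
    Δ-mK : Δ ∘ mK ≈ (mK ⊗₁ mK) ∘ ℓ⇐
    e-mK : e ∘ mK ≈ id
    !Δ-δ : ∀ {A} → !₁ (Δ {A}) ∘ δ ≈ m { !₀ A} { !₀ A} ∘ ((δ ⊗₁ δ) ∘ Δ)
    !e-δ : ∀ {A} → !₁ (e {A}) ∘ δ ≈ mK ∘ e

record LinearStructure {o h ℓe} (C : Category o h ℓe) : Set (o ⊔ h ⊔ ℓe) where
  field
    monoidal : SymmetricMonoidal C
    closed   : Closed monoidal
    modality : MonoidalCoalgebraModality monoidal

record LinearCategory (o h ℓe : Level) : Set (lsuc (o ⊔ h ⊔ ℓe)) where
  field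
    cat    : Category o h ℓe
    linear : LinearStructure cat
  open Category cat public
  open LinearStructure linear public
  open SymmetricMonoidal monoidal public
  open Closed closed public
  open MonoidalCoalgebraModality modality public

record AdditiveWithNegatives {o h ℓe} (𝕏 : LinearCategory o h ℓe) : Set (o ⊔ h ⊔ ℓe) where
  open LinearCategory 𝕏
  infixl 6 _+_
  field
    _+_ : ∀ {A B} → A ⇒ B → A ⇒ B → A ⇒ B
    0h  : ∀ {A B} → A ⇒ B
    +-assoc : ∀ {A B} {f g k : A ⇒ B} → (f + g) + k ≈ f + (g + k)
    +-comm  : ∀ {A B} {f g : A ⇒ B} → f + g ≈ g + f
    +-identityˡ : ∀ {A B} {f : A ⇒ B} → 0h + f ≈ f
    +-resp-≈ : ∀ {A B} {f f′ g g′ : A ⇒ B} → f ≈ f′ → g ≈ g′ → f + g ≈ f′ + g′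
    ∘-distribʳ : ∀ {A B C} {f g : B ⇒ C} {k : A ⇒ B} → (f + g) ∘ k ≈ (f ∘ k) + (g ∘ k)
    ∘-distribˡ : ∀ {A B C} {k : B ⇒ C} {f g : A ⇒ B} → k ∘ (f + g) ≈ (k ∘ f) + (k ∘ g)
    ∘-zeroʳ : ∀ {A B C} {k : A ⇒ B} → 0h {B} {C} ∘ k ≈ 0h
    ∘-zeroˡ : ∀ {A B C} {k : B ⇒ C} → k ∘ 0h {A} {B} ≈ 0h
    ⊗-distribʳ : ∀ {A B C D} {f g : A ⇒ B} {k : C ⇒ D} → (f + g) ⊗₁ k ≈ (f ⊗₁ k) + (g ⊗₁ k)
    ⊗-distribˡ : ∀ {A B C D} {k : C ⇒ D} {f g : A ⇒ B} → k ⊗₁ (f + g) ≈ (k ⊗₁ f) + (k ⊗₁ g)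
    ⊗-zeroʳ : ∀ {A B C D} {k : C ⇒ D} → 0h {A} {B} ⊗₁ k ≈ 0h
    ⊗-zeroˡ : ∀ {A B C D} {k : C ⇒ D} → k ⊗₁ 0h {A} {B} ≈ 0h
    negatives : ∀ {A B} (f : A ⇒ B) → ∃ λ g → f + g ≈ 0h

module _ {o h ℓe} (𝕏 : LinearCategory o h ℓe) where
  open LinearCategory 𝕏

  record IsMELLLiftingMonad
    (T₀ : Obj → Obj)
    (T₁ : ∀ {A B} → A ⇒ B → T₀ A ⇒ T₀ B)
    (μ  : ∀ {A} → T₀ (T₀ A) ⇒ T₀ A)
    (η  : ∀ {A} → A ⇒ T₀ A)
    (n  : ∀ {A B} → T₀ (A ⊗₀ B) ⇒ (T₀ A ⊗₀ T₀ B))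
    (nK : T₀ K ⇒ K)
    (λL : ∀ {A} → T₀ (!₀ A) ⇒ !₀ (T₀ A)) : Set (o ⊔ h ⊔ ℓe) where
    field
      T-id : ∀ {A} → T₁ (id {A}) ≈ id
      T-∘  : ∀ {A B C} {f : B ⇒ C} {g : A ⇒ B} → T₁ (f ∘ g) ≈ T₁ f ∘ T₁ g
      T-resp-≈ : ∀ {A B} {f g : A ⇒ B} → f ≈ g → T₁ f ≈ T₁ g
      μ-natural : ∀ {A B} {f : A ⇒ B} → T₁ f ∘ μ ≈ μ ∘ T₁ (T₁ f)
      η-natural : ∀ {A B} {f : A ⇒ B} → T₁ f ∘ η ≈ η ∘ f
      monad-assoc : ∀ {A} → μ {A} ∘ T₁ μ ≈ μ ∘ μ {T₀ A}
      monad-idˡ   : ∀ {A} → μ {A} ∘ T₁ η ≈ id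
      monad-idʳ   : ∀ {A} → μ {A} ∘ η {T₀ A} ≈ id
      n-natural : ∀ {A B C D} {f : A ⇒ B} {g : C ⇒ D} →
                  (T₁ f ⊗₁ T₁ g) ∘ n ≈ n ∘ T₁ (f ⊗₁ g)
      n-assoc : ∀ {A B C} →
        α⇒ ∘ ((id ⊗₁ n {B} {C}) ∘ n {A} {B ⊗₀ C})
          ≈ (n {A} {B} ⊗₁ id) ∘ (n {A ⊗₀ B} {C} ∘ T₁ α⇒)
      n-unitˡ : ∀ {A} → ℓ⇒ ∘ ((nK ⊗₁ id) ∘ n {K} {A}) ≈ T₁ ℓ⇒
      n-unitʳ : ∀ {A} → ρ⇒ ∘ ((id ⊗₁ nK) ∘ n {A} {K}) ≈ T₁ ρ⇒
      n-symmetric : ∀ {A B} → σ ∘ n {A} {B} ≈ n {B} {A} ∘ T₁ σ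
      μ-n  : ∀ {A B} → n {A} {B} ∘ μ ≈ (μ ⊗₁ μ) ∘ (n ∘ T₁ n)
      μ-nK : nK ∘ μ ≈ nK ∘ T₁ nK
      η-n  : ∀ {A B} → n {A} {B} ∘ η ≈ η ⊗₁ η
      η-nK : nK ∘ η ≈ id
      hopfˡ : ∀ {B C} → IsIso ((id ⊗₁ μ {C}) ∘ n {B} {T₀ C})
      hopfʳ : ∀ {B C} → IsIso ((μ {B} ⊗₁ id) ∘ n {T₀ B} {C})
      λ-natural : ∀ {A B} {f : A ⇒ B} → !₁ (T₁ f) ∘ λL ≈ λL ∘ T₁ (!₁ f)
      λ-μ : ∀ {B} → λL {B} ∘ μ ≈ !₁ μ ∘ (λL ∘ T₁ λL)
      λ-η : ∀ {B} → λL {B} ∘ η ≈ !₁ η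
      λ-δ : ∀ {B} → δ ∘ λL {B} ≈ !₁ λL ∘ (λL ∘ T₁ δ)
      λ-ε : ∀ {B} → ε ∘ λL {B} ≈ T₁ ε
      λ-m : ∀ {B C} →
        !₁ (n {B} {C}) ∘ (λL ∘ T₁ m) ≈ m ∘ ((λL ⊗₁ λL) ∘ n { !₀ B} { !₀ C})
      λ-mK : !₁ nK ∘ (λL ∘ T₁ mK) ≈ mK ∘ nK

module Construction {o h ℓe} (𝕏 : LinearCategory o h ℓe)
                    (Add : AdditiveWithNegatives 𝕏) (A : LinearCategory.Obj 𝕏) where
  open LinearCategory 𝕏
  open AdditiveWithNegatives Add

  ∇ : (!₀ A ⊗₀ !₀ A) ⇒ !₀ A
  ∇ = !₁ ((ρ⇒ ∘ (ε ⊗₁ e)) + (ℓ⇒ ∘ (e ⊗₁ ε))) ∘ (m { !₀ A} { !₀ A} ∘ (δ ⊗₁ δ))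

  u : K ⇒ !₀ A
  u = !₁ (0h {K} {A}) ∘ mK

  T₀ : Obj → Obj
  T₀ X = !₀ A ⊗₀ X

  T₁ : ∀ {X Y} → X ⇒ Y → T₀ X ⇒ T₀ Y
  T₁ f = id ⊗₁ f

  μ : ∀ {X} → T₀ (T₀ X) ⇒ T₀ X
  μ {X} = (∇ ⊗₁ id {X}) ∘ α⇒ { !₀ A} { !₀ A} {X}

  η : ∀ {X} → X ⇒ T₀ X
  η {X} = (u ⊗₁ id {X}) ∘ ℓ⇐

  n : ∀ {X Y} → T₀ (X ⊗₀ Y) ⇒ (T₀ X ⊗₀ T₀ Y)
  n {X} {Y} = τ { !₀ A} { !₀ A} {X} {Y} ∘ (Δ ⊗₁ id {X ⊗₀ Y})

  nK : T₀ K ⇒ K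
  nK = e ∘ ρ⇒ { !₀ A}

  λL : ∀ {X} → T₀ (!₀ X) ⇒ !₀ (T₀ X)
  λL {X} = m { !₀ A} {X} ∘ (δ ⊗₁ id { !₀ X})

  record Module : Set (o ⊔ h ⊔ ℓe) where
    field
      carrier : Obj
      act     : (!₀ A ⊗₀ carrier) ⇒ carrier
      act-assoc : act ∘ (id ⊗₁ act) ≈ act ∘ ((∇ ⊗₁ id) ∘ α⇒)
      act-unit  : act ∘ (u ⊗₁ id) ≈ ℓ⇒
  open Module public

  record ModuleHom (P Q : Module) : Set (h ⊔ ℓe) where
    field
      hom : carrier P ⇒ carrier Q
      commutes : hom ∘ act P ≈ act Q ∘ (id ⊗₁ hom)
  open ModuleHom public

  private
    module E {X Y : Obj} = IsEquivalence (equiv {X} {Y})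

  MOD-id : ∀ {P} → ModuleHom P P
  MOD-id {P} = record
    { hom = id
    ; commutes = E.trans identityˡ
        (E.sym (E.trans (∘-resp-≈ E.refl ⊗-id) identityʳ)) }

  MOD-∘ : ∀ {P Q R} → ModuleHom Q R → ModuleHom P Q → ModuleHom P R
  MOD-∘ {P} {Q} {R} g f = record
    { hom = hom g ∘ hom f
    ; commutes = begin
        (hom g ∘ hom f) ∘ act P            ≈⟨ assoc ⟩
        hom g ∘ (hom f ∘ act P)            ≈⟨ ∘-resp-≈ E.refl (commutes f) ⟩
        hom g ∘ (act Q ∘ (id ⊗₁ hom f))    ≈⟨ E.sym assoc ⟩
        (hom g ∘ act Q) ∘ (id ⊗₁ hom f)    ≈⟨ ∘-resp-≈ (commutes g) E.refl ⟩
        (act R ∘ (id ⊗₁ hom g)) ∘ (id ⊗₁ hom f)  ≈⟨ assoc ⟩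
        act R ∘ ((id ⊗₁ hom g) ∘ (id ⊗₁ hom f))  ≈⟨ ∘-resp-≈ E.refl (E.sym ⊗-∘) ⟩
        act R ∘ ((id ∘ id) ⊗₁ (hom g ∘ hom f))   ≈⟨ ∘-resp-≈ E.refl (⊗-resp-≈ identityˡ E.refl) ⟩
        act R ∘ (id ⊗₁ (hom g ∘ hom f))          ∎ }
    where open SetoidR (hom-setoid (!₀ A ⊗₀ carrier P) (carrier R))

  MOD : Category (o ⊔ h ⊔ ℓe) (h ⊔ ℓe) ℓe
  MOD = record
    { Obj = Module
    ; _⇒_ = ModuleHom
    ; _≈_ = λ f g → hom f ≈ hom g
    ; id = MOD-id
    ; _∘_ = MOD-∘
    ; equiv = record { refl = E.refl ; sym = E.sym ; trans = E.trans }
    ; assoc = assoc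
    ; identityˡ = identityˡ
    ; identityʳ = identityʳ
    ; ∘-resp-≈ = ∘-resp-≈ }

  ActEq : ∀ {X Y} → X ≡ Y → (!₀ A ⊗₀ X) ⇒ X → (!₀ A ⊗₀ Y) ⇒ Y → Set ℓe
  ActEq refl a b = a ≈ b

  HomEq : ∀ {X X′ Y Y′} → X ≡ X′ → Y ≡ Y′ → X ⇒ Y → X′ ⇒ Y′ → Set ℓe
  HomEq refl refl f g = f ≈ g

  HasStandardTensor : LinearStructure MOD → Set (o ⊔ h ⊔ ℓe)
  HasStandardTensor L =
      (∀ (P Q : Module) →
         Σ (carrier (P ⊗ᴸ Q) ≡ (carrier P ⊗₀ carrier Q)) λ eq →
           ActEq eq (act (P ⊗ᴸ Q)) ((act P ⊗₁ act Q) ∘ n {carrier P} {carrier Q}))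
    × (∀ {P P′ Q Q′ : Module} (f : ModuleHom P P′) (g : ModuleHom Q Q′) →
         Σ (carrier (P ⊗ᴸ Q) ≡ (carrier P ⊗₀ carrier Q)) λ eq₁ →
         Σ (carrier (P′ ⊗ᴸ Q′) ≡ (carrier P′ ⊗₀ carrier Q′)) λ eq₂ →
           HomEq eq₁ eq₂ (hom (f ⊗ᴸ₁ g)) (hom f ⊗₁ hom g))
    × (Σ (carrier Kᴸ ≡ K) λ eq → ActEq eq (act Kᴸ) nK)
    where
      open SymmetricMonoidal (LinearStructure.monoidal L)
        renaming (_⊗₀_ to _⊗ᴸ_; _⊗₁_ to _⊗ᴸ₁_; K to Kᴸ)
        using ()

{-# OPTIONS --safe #-}

-- !A is the cofree !-coalgebra on A, so a coalgebra map into !A is determined by its composite with ε.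
-- ∇ is the coalgebra map over the sum of the two "projections" !A ⊗ !A → A and u is the one over 0; hence the
-- monoid laws reduce to additive identities in A, and ∇ ∘ (!f ⊗ !g) ∘ Δ = !(f + g) makes !(-1) an antipode.
-- Thus H = !A is a cocommutative Hopf monoid, its fusion maps h ⊗ x ↦ h₁ ⊗ h₂x are inverted by
-- h ⊗ x ↦ h₁ ⊗ S(h₂)x, and every structure map of 𝕏 lifts to modules. The internal hom [M , N] carries the
-- action (h f)(x) = h₁ f(S(h₂) x).
module Submission where

open import Defs
open import Level using (_⊔_)
open import Data.Nat using (ℕ; suc)
open import Data.Product using (Σ; _×_; _,_; proj₁; proj₂)
open import Relation.Binary.PropositionalEquality using (refl)
open import Relation.Binary.Structures using (IsEquivalence)
import Relation.Binary.Reasoning.Setoid as SetoidR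

-- The axioms of the lifting monad mirror the bialgebra laws. Compatibility of `∇` and `u` with `δ`
-- gives `λ-μ` and `λ-η`; their compatibility with `Δ` and `e` makes `μ` and `η` comonoidal;
-- cocommutativity makes `n` symmetric; the antipode supplies the Hopf condition. The obstacle is
-- bookkeeping: each such step sits between associators, unitors and symmetries. Maps are therefore
-- quoted as terms and put into a form certified equal to the original, and a proof becomes a chain
-- of terms whose rules mark the subterms being rewritten. Functoriality, naturality and
-- cancellation of structural inverses between consecutive terms are then checked by computation, so
-- that a chain cites only algebraic laws and genuine coherence. The antipode is needed again for
-- closedness: the action on an internal hom is obtained by inverting a fusion map, and its laws
-- follow from those of the fusion map.

module HomReasoning {o h ℓe} (C : Category o h ℓe) where
  open Category C

  module _ {X Y : Obj} where
    open IsEquivalence (equiv {X} {Y}) public using () renaming (refl to ≈-refl; sym to ≈-sym; trans to ≈-trans)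
    open SetoidR (hom-setoid X Y) public

  private
    variable
      X Y Z W V : Obj

  infixr 4 _⟩∘⟨_ refl⟩∘⟨_
  infixl 5 _⟩∘⟨refl

  _⟩∘⟨_ : {f f′ : Y ⇒ Z} {g g′ : X ⇒ Y} → f ≈ f′ → g ≈ g′ → f ∘ g ≈ f′ ∘ g′
  _⟩∘⟨_ = ∘-resp-≈

  refl⟩∘⟨_ : {f : Y ⇒ Z} {g g′ : X ⇒ Y} → g ≈ g′ → f ∘ g ≈ f ∘ g′
  refl⟩∘⟨ p = ∘-resp-≈ ≈-refl p

  _⟩∘⟨refl : {f f′ : Y ⇒ Z} {g : X ⇒ Y} → f ≈ f′ → f ∘ g ≈ f′ ∘ g
  p ⟩∘⟨refl = ∘-resp-≈ p ≈-refl

  cancelˡ : {f : Y ⇒ Z} {g : Z ⇒ Y} {k : X ⇒ Z} → f ∘ g ≈ id → f ∘ (g ∘ k) ≈ k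
  cancelˡ p = ≈-trans (≈-sym assoc) (≈-trans (p ⟩∘⟨refl) identityˡ)

  extendʳ : {f : Y ⇒ Z} {g : X ⇒ Y} {f′ : W ⇒ Z} {g′ : X ⇒ W} {k : V ⇒ X} →
            f ∘ g ≈ f′ ∘ g′ → f ∘ (g ∘ k) ≈ f′ ∘ (g′ ∘ k)
  extendʳ p = ≈-trans (≈-sym assoc) (≈-trans (p ⟩∘⟨refl) assoc)

  pullˡ : {f : Y ⇒ Z} {g : X ⇒ Y} {a : X ⇒ Z} {k : W ⇒ X} →
          f ∘ g ≈ a → f ∘ (g ∘ k) ≈ a ∘ k
  pullˡ p = ≈-trans (≈-sym assoc) (p ⟩∘⟨refl)

-- Certified normal forms for maps built from the structure of a linear category.

module Normaliser {o h ℓe} (𝕏 : LinearCategory o h ℓe) where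
  open LinearCategory 𝕏
  open HomReasoning cat

  infixr 10 _⊗_
  infix  11 !_ `_

  -- Quoting turns tensor and `!` into constructors, so that the normaliser can match on the shape
  -- of objects; the operations `_⊗₀_` and `!₀` themselves are not known to be injective.
  data Ob : Set o where
    `_  : Obj → Ob
    𝟙   : Ob
    _⊗_ : Ob → Ob → Ob
    !_  : Ob → Ob

  ⟦_⟧₀ : Ob → Obj
  ⟦ ` X ⟧₀   = X
  ⟦ 𝟙 ⟧₀     = K
  ⟦ X ⊗ Y ⟧₀ = ⟦ X ⟧₀ ⊗₀ ⟦ Y ⟧₀
  ⟦ ! X ⟧₀   = !₀ ⟦ X ⟧₀

  _⟶_ : Ob → Ob → Set h
  X ⟶ Y = ⟦ X ⟧₀ ⇒ ⟦ Y ⟧₀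

  private
    variable
      X Y Z W X′ Y′ Z′ : Ob

  -- l, r, s stand for ℓ, ρ, σ.
  data Gen : Ob → Ob → Set o where
    α   : Gen (X ⊗ (Y ⊗ Z)) ((X ⊗ Y) ⊗ Z)
    α⁻  : Gen ((X ⊗ Y) ⊗ Z) (X ⊗ (Y ⊗ Z))
    l   : Gen (𝟙 ⊗ X) X
    l⁻  : Gen X (𝟙 ⊗ X)
    r   : Gen (X ⊗ 𝟙) X
    r⁻  : Gen X (X ⊗ 𝟙)
    s   : Gen (X ⊗ Y) (Y ⊗ X)
    mᵍ  : Gen (! X ⊗ ! Y) (! (X ⊗ Y))
    mKᵍ : Gen 𝟙 (! 𝟙)
    δᵍ  : Gen (! X) (! ! X)
    εᵍ  : Gen (! X) X
    Δᵍ  : Gen (! X) (! X ⊗ ! X)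
    eᵍ  : Gen (! X) 𝟙

  ⟦_⟧ᵍ : Gen X Y → X ⟶ Y
  ⟦ α ⟧ᵍ    = α⇒
  ⟦ α⁻ ⟧ᵍ   = α⇐
  ⟦ l ⟧ᵍ    = ℓ⇒
  ⟦ l⁻ ⟧ᵍ   = ℓ⇐
  ⟦ r ⟧ᵍ    = ρ⇒
  ⟦ r⁻ ⟧ᵍ   = ρ⇐
  ⟦ s ⟧ᵍ    = σ
  ⟦ mᵍ ⟧ᵍ   = m
  ⟦ mKᵍ ⟧ᵍ  = mK
  ⟦ δᵍ ⟧ᵍ   = δ
  ⟦ εᵍ ⟧ᵍ   = ε
  ⟦ Δᵍ ⟧ᵍ   = Δ
  ⟦ eᵍ ⟧ᵍ   = e

  infixr 8 _∷_

  -- Maps modulo functoriality of ⊗ and !, with structural isomorphisms cancelled and all structure maps pushed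
  -- towards the input by naturality. The form is not canonical for coherence (pentagon, triangle, hexagon).
  mutual
    data NF : Ob → Ob → Set (o ⊔ h) where
      []  : NF X X
      _∷_ : Fac Y Z → NF X Y → NF X Z

    data Fac : Ob → Ob → Set (o ⊔ h) where
      atom : X ⟶ Y → Fac X Y
      gen  : Gen X Y → Fac X Y
      _⊗_  : NF X Y → NF Z W → Fac (X ⊗ Z) (Y ⊗ W)
      !_   : NF X Y → Fac (! X) (! Y)

  mutual
    ⟦_⟧ⁿ : NF X Y → X ⟶ Y
    ⟦ [] ⟧ⁿ    = id
    ⟦ f ∷ p ⟧ⁿ = ⟦ f ⟧ᶠ ∘ ⟦ p ⟧ⁿ

    ⟦_⟧ᶠ : Fac X Y → X ⟶ Y
    ⟦ atom f ⟧ᶠ = f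
    ⟦ gen g ⟧ᶠ  = ⟦ g ⟧ᵍ
    ⟦ p ⊗ q ⟧ᶠ  = ⟦ p ⟧ⁿ ⊗₁ ⟦ q ⟧ⁿ
    ⟦ ! p ⟧ᶠ    = !₁ ⟦ p ⟧ⁿ

  record Norm X Y (f : X ⟶ Y) : Set (o ⊔ h ⊔ ℓe) where
    constructor _by_
    field
      form : NF X Y
      cert : ⟦ form ⟧ⁿ ≈ f
  open Norm

  conv : {f g : X ⟶ Y} → Norm X Y f → f ≈ g → Norm X Y g
  conv (p by c) eq = p by ≈-trans c eq

  exact : (p : NF X Y) → Norm X Y ⟦ p ⟧ⁿ
  exact p = p by ≈-refl

  single : (f : Fac X Y) → Norm X Y ⟦ f ⟧ᶠ
  single f = (f ∷ []) by identityʳ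

  -- Only a tensor layer can cross an associator. The outermost one of `q` is exposed here, and the
  -- remainder stays on the input side.
  record Split⊗ (q : NF X (Y ⊗ Z)) : Set (o ⊔ h ⊔ ℓe) where
    constructor split
    field
      {Y₀ Z₀} : Ob
      left    : NF Y₀ Y
      right   : NF Z₀ Z
      rest    : NF X (Y₀ ⊗ Z₀)
      eq      : ⟦ q ⟧ⁿ ≈ (⟦ left ⟧ⁿ ⊗₁ ⟦ right ⟧ⁿ) ∘ ⟦ rest ⟧ⁿ

  split⊗ : (q : NF X (Y ⊗ Z)) → Split⊗ q
  split⊗ ((p ⊗ q) ∷ x) = split p q x ≈-refl
  split⊗ x = split [] [] x (≈-sym (≈-trans (⊗-id ⟩∘⟨refl) identityˡ))

  record Split! (q : NF X (! Y)) : Set (o ⊔ h ⊔ ℓe) where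
    constructor split
    field
      {Y₀} : Ob
      box  : NF Y₀ Y
      rest : NF X (! Y₀)
      eq   : ⟦ q ⟧ⁿ ≈ !₁ ⟦ box ⟧ⁿ ∘ ⟦ rest ⟧ⁿ

  split! : (q : NF X (! Y)) → Split! q
  split! ((! p) ∷ x) = split p x ≈-refl
  split! x = split [] x (≈-sym (≈-trans (!-id ⟩∘⟨refl) identityˡ))

  tens : (p : NF X Y) (q : NF Z W) → Norm (X ⊗ Z) (Y ⊗ W) (⟦ p ⟧ⁿ ⊗₁ ⟦ q ⟧ⁿ)
  tens [] [] = [] by ≈-sym ⊗-id
  tens p q = single (p ⊗ q)

  bang : (p : NF X Y) → Norm (! X) (! Y) (!₁ ⟦ p ⟧ⁿ)
  bang [] = [] by ≈-sym !-id
  bang p = single (! p)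

  ⊗-split : {A B C D E F G : Obj} {f : B ⇒ C} {g : A ⇒ B} {k : E ⇒ F} {i : D ⇒ E} {x : G ⇒ (A ⊗₀ D)} →
            (f ⊗₁ k) ∘ ((g ⊗₁ i) ∘ x) ≈ ((f ∘ g) ⊗₁ (k ∘ i)) ∘ x
  ⊗-split = pullˡ (≈-sym ⊗-∘)

  α⇐-natural : {A B C D E F : Obj} {f : A ⇒ D} {g : B ⇒ E} {k : C ⇒ F} →
               α⇐ ∘ ((f ⊗₁ g) ⊗₁ k) ≈ (f ⊗₁ (g ⊗₁ k)) ∘ α⇐
  α⇐-natural {f = f} {g} {k} = begin
    α⇐ ∘ ((f ⊗₁ g) ⊗₁ k)                ≈⟨ refl⟩∘⟨ identityʳ ⟨
    α⇐ ∘ (((f ⊗₁ g) ⊗₁ k) ∘ id)         ≈⟨ refl⟩∘⟨ refl⟩∘⟨ α-isoʳ ⟨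
    α⇐ ∘ (((f ⊗₁ g) ⊗₁ k) ∘ (α⇒ ∘ α⇐))  ≈⟨ refl⟩∘⟨ extendʳ α-natural ⟨
    α⇐ ∘ (α⇒ ∘ ((f ⊗₁ (g ⊗₁ k)) ∘ α⇐))  ≈⟨ cancelˡ α-isoˡ ⟩
    (f ⊗₁ (g ⊗₁ k)) ∘ α⇐                ∎

  ℓ⇐-natural : {A B : Obj} {f : A ⇒ B} → ℓ⇐ ∘ f ≈ (id ⊗₁ f) ∘ ℓ⇐
  ℓ⇐-natural {f = f} = begin
    ℓ⇐ ∘ f                        ≈⟨ refl⟩∘⟨ identityʳ ⟨
    ℓ⇐ ∘ (f ∘ id)                 ≈⟨ refl⟩∘⟨ refl⟩∘⟨ ℓ-isoʳ ⟨
    ℓ⇐ ∘ (f ∘ (ℓ⇒ ∘ ℓ⇐))          ≈⟨ refl⟩∘⟨ extendʳ ℓ-natural ⟨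
    ℓ⇐ ∘ (ℓ⇒ ∘ ((id ⊗₁ f) ∘ ℓ⇐))  ≈⟨ cancelˡ ℓ-isoˡ ⟩
    (id ⊗₁ f) ∘ ℓ⇐                ∎

  ρ⇐-natural : {A B : Obj} {f : A ⇒ B} → ρ⇐ ∘ f ≈ (f ⊗₁ id) ∘ ρ⇐
  ρ⇐-natural {f = f} = begin
    ρ⇐ ∘ f                        ≈⟨ refl⟩∘⟨ identityʳ ⟨
    ρ⇐ ∘ (f ∘ id)                 ≈⟨ refl⟩∘⟨ refl⟩∘⟨ ρ-isoʳ ⟨
    ρ⇐ ∘ (f ∘ (ρ⇒ ∘ ρ⇐))          ≈⟨ refl⟩∘⟨ extendʳ ρ-natural ⟨
    ρ⇐ ∘ (ρ⇒ ∘ ((f ⊗₁ id) ∘ ρ⇐))  ≈⟨ cancelˡ ρ-isoˡ ⟩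
    (f ⊗₁ id) ∘ ρ⇐                ∎

  ⊗-interchange : {A B C D : Obj} {f : A ⇒ B} {g : C ⇒ D} → f ⊗₁ g ≈ (id ⊗₁ g) ∘ (f ⊗₁ id)
  ⊗-interchange = ≈-trans (⊗-resp-≈ (≈-sym identityˡ) (≈-sym identityʳ)) ⊗-∘

  ⊗-interchange′ : {A B C D : Obj} {f : A ⇒ B} {g : C ⇒ D} → f ⊗₁ g ≈ (f ⊗₁ id) ∘ (id ⊗₁ g)
  ⊗-interchange′ = ≈-trans (⊗-resp-≈ (≈-sym identityʳ) (≈-sym identityˡ)) ⊗-∘

  -- The natural number is fuel; running out of it only leaves a form less reduced.
  mutual
    comp : ℕ → (p : NF Y Z) (q : NF X Y) → Norm X Z (⟦ p ⟧ⁿ ∘ ⟦ q ⟧ⁿ)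
    comp n [] q = q by ≈-sym identityˡ
    comp n (f ∷ p) q = conv (consᶜ n f (comp n p q)) (≈-sym assoc)

    consᶜ : ℕ → (f : Fac Y Z) {g : X ⟶ Y} → Norm X Y g → Norm X Z (⟦ f ⟧ᶠ ∘ g)
    consᶜ n f (x by c) = conv (cons n f x) (refl⟩∘⟨ c)

    cons : ℕ → (f : Fac Y Z) (x : NF X Y) → Norm X Z (⟦ f ⟧ᶠ ∘ ⟦ x ⟧ⁿ)
    cons n (atom f) x = (atom f ∷ x) by ≈-refl
    cons n (gen g) x = push n g x
    cons n (p ⊗ q) x = cons⊗ n p q x
    cons n (! p) x = cons! n p x

    cons⊗ : ℕ → (p : NF Y Z) (q : NF Y′ Z′) (x : NF X (Y ⊗ Y′)) →
            Norm X (Z ⊗ Z′) ((⟦ p ⟧ⁿ ⊗₁ ⟦ q ⟧ⁿ) ∘ ⟦ x ⟧ⁿ)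
    cons⊗ n [] [] x = x by ≈-sym (≈-trans (⊗-id ⟩∘⟨refl) identityˡ)
    cons⊗ (suc n) p q ((p′ ⊗ q′) ∷ x) = conv (merge (comp n p p′) (comp n q q′) x) (≈-sym ⊗-split)
    cons⊗ n p q x = (p ⊗ q ∷ x) by ≈-refl

    merge : {f : Y ⟶ Z} {g : Y′ ⟶ Z′} → Norm Y Z f → Norm Y′ Z′ g → (x : NF X (Y ⊗ Y′)) →
            Norm X (Z ⊗ Z′) ((f ⊗₁ g) ∘ ⟦ x ⟧ⁿ)
    merge ([] by c) ([] by d) x = x by ≈-trans (≈-sym identityˡ) (≈-trans (≈-sym ⊗-id) (⊗-resp-≈ c d) ⟩∘⟨refl)
    merge (p by c) (q by d) x = (p ⊗ q ∷ x) by (⊗-resp-≈ c d ⟩∘⟨refl)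

    cons! : ℕ → (p : NF Y Z) (x : NF X (! Y)) → Norm X (! Z) (!₁ ⟦ p ⟧ⁿ ∘ ⟦ x ⟧ⁿ)
    cons! n [] x = x by ≈-sym (≈-trans (!-id ⟩∘⟨refl) identityˡ)
    cons! (suc n) p ((! p′) ∷ x) = conv (merge! (comp n p p′) x) (≈-trans (!-∘ ⟩∘⟨refl) assoc)
    cons! n p x = (! p ∷ x) by ≈-refl

    merge! : {f : Y ⟶ Z} → Norm Y Z f → (x : NF X (! Y)) → Norm X (! Z) (!₁ f ∘ ⟦ x ⟧ⁿ)
    merge! ([] by c) x = x by ≈-trans (≈-sym identityˡ) (≈-trans (≈-sym !-id) (!-resp-≈ c) ⟩∘⟨refl)
    merge! (p by c) x = (! p ∷ x) by (!-resp-≈ c ⟩∘⟨refl)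

    push : ℕ → (g : Gen Y Z) (x : NF X Y) → Norm X Z (⟦ g ⟧ᵍ ∘ ⟦ x ⟧ⁿ)
    push n α (gen α⁻ ∷ x) = x by ≈-sym (cancelˡ α-isoʳ)
    push n α⁻ (gen α ∷ x) = x by ≈-sym (cancelˡ α-isoˡ)
    push n l (gen l⁻ ∷ x) = x by ≈-sym (cancelˡ ℓ-isoʳ)
    push n l⁻ (gen l ∷ x) = x by ≈-sym (cancelˡ ℓ-isoˡ)
    push n r (gen r⁻ ∷ x) = x by ≈-sym (cancelˡ ρ-isoʳ)
    push n r⁻ (gen r ∷ x) = x by ≈-sym (cancelˡ ρ-isoˡ)
    push n s (gen s ∷ x) = x by ≈-sym (cancelˡ σ-involutive)
    push (suc n) α ((p ⊗ q) ∷ x) = pushα n p q (split⊗ q) x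
    push (suc n) α⁻ ((p ⊗ q) ∷ x) = pushα⁻ n p q (split⊗ p) x
    push (suc n) l ((p ⊗ []) ∷ x) = (gen l ∷ (p ⊗ []) ∷ x) by ≈-refl
    push (suc n) l ((p ⊗ q) ∷ x) =
      conv (compᶜ n q (pushᶜ n l (cons⊗ n p [] x)))
           (≈-sym (≈-trans (refl⟩∘⟨ ≈-trans (⊗-interchange ⟩∘⟨refl) assoc) (extendʳ ℓ-natural)))
    push (suc n) r (([] ⊗ q) ∷ x) = (gen r ∷ ([] ⊗ q) ∷ x) by ≈-refl
    push (suc n) r ((p ⊗ q) ∷ x) =
      conv (compᶜ n p (pushᶜ n r (cons⊗ n [] q x)))
           (≈-sym (≈-trans (refl⟩∘⟨ ≈-trans (⊗-interchange′ ⟩∘⟨refl) assoc) (extendʳ ρ-natural)))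
    push (suc n) l⁻ (f ∷ x) =
      conv (cons⊗ᶜ n (exact []) (single f) (push n l⁻ x)) (≈-sym (extendʳ ℓ⇐-natural))
    push (suc n) r⁻ (f ∷ x) =
      conv (cons⊗ᶜ n (single f) (exact []) (push n r⁻ x)) (≈-sym (extendʳ ρ⇐-natural))
    push (suc n) s ((p ⊗ q) ∷ x) =
      conv (cons⊗ᶜ n (exact q) (exact p) (push n s x)) (≈-sym (extendʳ σ-natural))
    push (suc n) mᵍ ((p ⊗ q) ∷ x) = pushm n p q (split! p) (split! q) x
    push (suc n) δᵍ ((! p) ∷ x) =
      conv (cons!ᶜ n (single (! p)) (push n δᵍ x)) (extendʳ δ-natural)
    push (suc n) εᵍ ((! p) ∷ x) = conv (compᶜ n p (push n εᵍ x)) (extendʳ ε-natural)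
    push (suc n) Δᵍ ((! p) ∷ x) =
      conv (cons⊗ᶜ n (single (! p)) (single (! p)) (push n Δᵍ x)) (extendʳ Δ-natural)
    push (suc n) eᵍ ((! p) ∷ x) = conv (push n eᵍ x) (≈-sym (pullˡ e-natural))
    push n g x = (gen g ∷ x) by ≈-refl

    compᶜ : ℕ → (p : NF Y Z) {g : X ⟶ Y} → Norm X Y g → Norm X Z (⟦ p ⟧ⁿ ∘ g)
    compᶜ n p (x by c) = conv (comp n p x) (refl⟩∘⟨ c)

    pushᶜ : ℕ → (g : Gen Y Z) {f : X ⟶ Y} → Norm X Y f → Norm X Z (⟦ g ⟧ᵍ ∘ f)
    pushᶜ n g (x by c) = conv (push n g x) (refl⟩∘⟨ c)

    cons⊗ᶜ : ℕ → {f : Y ⟶ Z} {g : Y′ ⟶ Z′} {k : X ⟶ (Y ⊗ Y′)} →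
             Norm Y Z f → Norm Y′ Z′ g → Norm X (Y ⊗ Y′) k → Norm X (Z ⊗ Z′) ((f ⊗₁ g) ∘ k)
    cons⊗ᶜ n (p by c) (q by d) (x by b) = conv (cons⊗ n p q x) (⊗-resp-≈ c d ⟩∘⟨ b)

    cons!ᶜ : ℕ → {f : Y ⟶ Z} {g : X ⟶ (! Y)} → Norm Y Z f → Norm X (! Y) g → Norm X (! Z) (!₁ f ∘ g)
    cons!ᶜ n (p by c) (x by b) = conv (cons! n p x) (!-resp-≈ c ⟩∘⟨ b)

    pushα : ℕ → (p : NF X′ X) (q : NF W (Y ⊗ Z)) → Split⊗ q → (x : NF Z′ (X′ ⊗ W)) →
            Norm Z′ ((X ⊗ Y) ⊗ Z) (α⇒ ∘ ((⟦ p ⟧ⁿ ⊗₁ ⟦ q ⟧ⁿ) ∘ ⟦ x ⟧ⁿ))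
    -- Nothing can cross `α` here; the general clause would only reproduce the same redex.
    pushα n [] q (split [] [] _ _) x = (gen α ∷ ([] ⊗ q) ∷ x) by ≈-refl
    pushα n p q (split q₁ q₂ q₀ c) x = conv
      (cons⊗ᶜ n (tens p q₁) (exact q₂) (pushᶜ n α (cons⊗ n [] q₀ x)))
      (begin
        ((⟦ p ⟧ⁿ ⊗₁ ⟦ q₁ ⟧ⁿ) ⊗₁ ⟦ q₂ ⟧ⁿ) ∘ (α⇒ ∘ ((id ⊗₁ ⟦ q₀ ⟧ⁿ) ∘ ⟦ x ⟧ⁿ))  ≈⟨ extendʳ α-natural ⟨
        α⇒ ∘ ((⟦ p ⟧ⁿ ⊗₁ (⟦ q₁ ⟧ⁿ ⊗₁ ⟦ q₂ ⟧ⁿ)) ∘ ((id ⊗₁ ⟦ q₀ ⟧ⁿ) ∘ ⟦ x ⟧ⁿ))  ≈⟨ refl⟩∘⟨ ⊗-split ⟩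
        α⇒ ∘ (((⟦ p ⟧ⁿ ∘ id) ⊗₁ ((⟦ q₁ ⟧ⁿ ⊗₁ ⟦ q₂ ⟧ⁿ) ∘ ⟦ q₀ ⟧ⁿ)) ∘ ⟦ x ⟧ⁿ)    ≈⟨ refl⟩∘⟨ ⊗-resp-≈ identityʳ (≈-sym c) ⟩∘⟨refl ⟩
        α⇒ ∘ ((⟦ p ⟧ⁿ ⊗₁ ⟦ q ⟧ⁿ) ∘ ⟦ x ⟧ⁿ)                                     ∎)

    pushα⁻ : ℕ → (p : NF W (X ⊗ Y)) (q : NF Z′ Z) → Split⊗ p → (x : NF X′ (W ⊗ Z′)) →
             Norm X′ (X ⊗ (Y ⊗ Z)) (α⇐ ∘ ((⟦ p ⟧ⁿ ⊗₁ ⟦ q ⟧ⁿ) ∘ ⟦ x ⟧ⁿ))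
    pushα⁻ n p [] (split [] [] _ _) x = (gen α⁻ ∷ (p ⊗ []) ∷ x) by ≈-refl
    pushα⁻ n p q (split p₁ p₂ p₀ c) x = conv
      (cons⊗ᶜ n (exact p₁) (tens p₂ q) (pushᶜ n α⁻ (cons⊗ n p₀ [] x)))
      (begin
        (⟦ p₁ ⟧ⁿ ⊗₁ (⟦ p₂ ⟧ⁿ ⊗₁ ⟦ q ⟧ⁿ)) ∘ (α⇐ ∘ ((⟦ p₀ ⟧ⁿ ⊗₁ id) ∘ ⟦ x ⟧ⁿ))  ≈⟨ extendʳ α⇐-natural ⟨
        α⇐ ∘ (((⟦ p₁ ⟧ⁿ ⊗₁ ⟦ p₂ ⟧ⁿ) ⊗₁ ⟦ q ⟧ⁿ) ∘ ((⟦ p₀ ⟧ⁿ ⊗₁ id) ∘ ⟦ x ⟧ⁿ))  ≈⟨ refl⟩∘⟨ ⊗-split ⟩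
        α⇐ ∘ ((((⟦ p₁ ⟧ⁿ ⊗₁ ⟦ p₂ ⟧ⁿ) ∘ ⟦ p₀ ⟧ⁿ) ⊗₁ (⟦ q ⟧ⁿ ∘ id)) ∘ ⟦ x ⟧ⁿ)    ≈⟨ refl⟩∘⟨ ⊗-resp-≈ (≈-sym c) identityʳ ⟩∘⟨refl ⟩
        α⇐ ∘ ((⟦ p ⟧ⁿ ⊗₁ ⟦ q ⟧ⁿ) ∘ ⟦ x ⟧ⁿ)                                     ∎)

    pushm : ℕ → (p : NF X (! Y)) (q : NF X′ (! Y′)) → Split! p → Split! q → (x : NF W (X ⊗ X′)) →
            Norm W (! (Y ⊗ Y′)) (m ∘ ((⟦ p ⟧ⁿ ⊗₁ ⟦ q ⟧ⁿ) ∘ ⟦ x ⟧ⁿ))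
    pushm n p q (split [] _ _) (split [] _ _) x = (gen mᵍ ∷ (p ⊗ q) ∷ x) by ≈-refl
    pushm n p q (split p₁ p₀ c) (split q₁ q₀ d) x = conv
      (cons!ᶜ n (tens p₁ q₁) (pushᶜ n mᵍ (cons⊗ n p₀ q₀ x)))
      (begin
        !₁ (⟦ p₁ ⟧ⁿ ⊗₁ ⟦ q₁ ⟧ⁿ) ∘ (m ∘ ((⟦ p₀ ⟧ⁿ ⊗₁ ⟦ q₀ ⟧ⁿ) ∘ ⟦ x ⟧ⁿ))        ≈⟨ extendʳ m-natural ⟨
        m ∘ ((!₁ ⟦ p₁ ⟧ⁿ ⊗₁ !₁ ⟦ q₁ ⟧ⁿ) ∘ ((⟦ p₀ ⟧ⁿ ⊗₁ ⟦ q₀ ⟧ⁿ) ∘ ⟦ x ⟧ⁿ))    ≈⟨ refl⟩∘⟨ ⊗-split ⟩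
        m ∘ (((!₁ ⟦ p₁ ⟧ⁿ ∘ ⟦ p₀ ⟧ⁿ) ⊗₁ (!₁ ⟦ q₁ ⟧ⁿ ∘ ⟦ q₀ ⟧ⁿ)) ∘ ⟦ x ⟧ⁿ)      ≈⟨ refl⟩∘⟨ ⊗-resp-≈ (≈-sym c) (≈-sym d) ⟩∘⟨refl ⟩
        m ∘ ((⟦ p ⟧ⁿ ⊗₁ ⟦ q ⟧ⁿ) ∘ ⟦ x ⟧ⁿ)                                       ∎)

  infixr 9 _·_

  -- A term containing rules denotes a 2-cell: src reads every rule as its left-hand side, tgt as its right-hand side.
  mutual
    data Term : Ob → Ob → Set (o ⊔ h ⊔ ℓe) where
      ι    : Term X X
      _·_  : Term Y Z → Term X Y → Term X Z
      _⊗_  : Term X Y → Term Z W → Term (X ⊗ Z) (Y ⊗ W)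
      !_   : Term X Y → Term (! X) (! Y)
      atom : X ⟶ Y → Term X Y
      gen  : Gen X Y → Term X Y
      rule : (f g : Term X Y) → ⟦ f ⟧ ≈ ⟦ g ⟧ → Term X Y

    ⟦_⟧ : Term X Y → X ⟶ Y
    ⟦ ι ⟧          = id
    ⟦ f · g ⟧      = ⟦ f ⟧ ∘ ⟦ g ⟧
    ⟦ f ⊗ g ⟧      = ⟦ f ⟧ ⊗₁ ⟦ g ⟧
    ⟦ ! f ⟧        = !₁ ⟦ f ⟧
    ⟦ atom f ⟧     = f
    ⟦ gen g ⟧      = ⟦ g ⟧ᵍ
    ⟦ rule f g _ ⟧ = ⟦ f ⟧

  fuel : ℕ
  fuel = 100

  compᵗ : {f : Y ⟶ Z} {g : X ⟶ Y} → Norm Y Z f → Norm X Y g → Norm X Z (f ∘ g)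
  compᵗ (p by c) (q by d) = conv (comp fuel p q) (c ⟩∘⟨ d)

  tensᵗ : {f : X ⟶ Y} {g : Z ⟶ W} → Norm X Y f → Norm Z W g → Norm (X ⊗ Z) (Y ⊗ W) (f ⊗₁ g)
  tensᵗ (p by c) (q by d) = conv (tens p q) (⊗-resp-≈ c d)

  bangᵗ : {f : X ⟶ Y} → Norm X Y f → Norm (! X) (! Y) (!₁ f)
  bangᵗ (p by c) = conv (bang p) (!-resp-≈ c)

  normₛ normₜ : (f : Term X Y) → Norm X Y ⟦ f ⟧
  normₛ ι            = exact []
  normₛ (f · g)      = compᵗ (normₛ f) (normₛ g)
  normₛ (f ⊗ g)      = tensᵗ (normₛ f) (normₛ g)
  normₛ (! f)        = bangᵗ (normₛ f)
  normₛ (atom f)     = single (atom f)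
  normₛ (gen g)      = single (gen g)
  normₛ (rule f g _) = normₛ f

  normₜ ι            = exact []
  normₜ (f · g)      = compᵗ (normₜ f) (normₜ g)
  normₜ (f ⊗ g)      = tensᵗ (normₜ f) (normₜ g)
  normₜ (! f)        = bangᵗ (normₜ f)
  normₜ (atom f)     = single (atom f)
  normₜ (gen g)      = single (gen g)
  normₜ (rule f g e) = conv (normₜ g) (≈-sym e)

  src tgt : Term X Y → NF X Y
  src f = form (normₛ f)
  tgt f = form (normₜ f)

  infixr 3 _⨾_
  infix 4 _≋_

  -- Consecutive 2-cells only have to match up to normal form, which Agda checks by computation.
  data Chain {X Y} : NF X Y → NF X Y → Set (o ⊔ h ⊔ ℓe) where
    done : {p : NF X Y} → Chain p p
    _⨾_  : {p : NF X Y} (f : Term X Y) → Chain (tgt f) p → Chain (src f) p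

  -- Wrapped in a record so that the two terms can be recovered from the type of a proof; the
  -- interpretation `⟦_⟧` is not injective.
  record _≋_ {X Y} (f g : Term X Y) : Set ℓe where
    constructor ≋-intro
    field eq : ⟦ f ⟧ ≈ ⟦ g ⟧
  open _≋_ public

  chain-sound : {p q : NF X Y} → Chain p q → ⟦ p ⟧ⁿ ≈ ⟦ q ⟧ⁿ
  chain-sound done    = ≈-refl
  chain-sound (f ⨾ c) = ≈-trans (cert (normₛ f)) (≈-trans (≈-sym (cert (normₜ f))) (chain-sound c))

  -- With `done` alone it settles equations whose two sides have the same normal form, such as
  -- naturality of `μ` and `n`.
  chain : {f g : Term X Y} → Chain (src f) (src g) → f ≋ g
  chain {f = f} {g} c = ≋-intro (≈-trans (≈-sym (cert (normₛ f))) (≈-trans (chain-sound c) (cert (normₛ g))))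

  ⟪_⟫ ⟪_⟫⁻ : {f g : Term X Y} → f ≋ g → Term X Y
  ⟪_⟫ {f = f} {g} p = rule f g (eq p)
  ⟪_⟫⁻ {f = f} {g} p = rule g f (≈-sym (eq p))

-- Symmetric monoidal coherence, and the laws of the modality as rules.

module Terms {o h ℓe} (𝕏 : LinearCategory o h ℓe) where
  open Normaliser 𝕏 public using
    (Ob; `_; 𝟙; _⊗_; !_; ⟦_⟧₀; _⟶_; Term; ι; _·_; atom; ⟦_⟧; done; _⨾_; _≋_; ≋-intro; eq; chain; ⟪_⟫; ⟪_⟫⁻)
  open Normaliser 𝕏 using (gen)
  private
    module N = Normaliser 𝕏
    module 𝕏 = LinearCategory 𝕏
    variable
      X Y Z W A B C D A′ B′ C′ : Ob

  α : Term (X ⊗ (Y ⊗ Z)) ((X ⊗ Y) ⊗ Z)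
  α = gen N.α
  α⁻ : Term ((X ⊗ Y) ⊗ Z) (X ⊗ (Y ⊗ Z))
  α⁻ = gen N.α⁻
  l : Term (𝟙 ⊗ X) X
  l = gen N.l
  l⁻ : Term X (𝟙 ⊗ X)
  l⁻ = gen N.l⁻
  r : Term (X ⊗ 𝟙) X
  r = gen N.r
  r⁻ : Term X (X ⊗ 𝟙)
  r⁻ = gen N.r⁻
  s : Term (X ⊗ Y) (Y ⊗ X)
  s = gen N.s
  m : Term (! X ⊗ ! Y) (! (X ⊗ Y))
  m = gen N.mᵍ
  mK : Term 𝟙 (! 𝟙)
  mK = gen N.mKᵍ
  δ : Term (! X) (! ! X)
  δ = gen N.δᵍ
  ε : Term (! X) X
  ε = gen N.εᵍ
  Δ : Term (! X) (! X ⊗ ! X)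
  Δ = gen N.Δᵍ
  e : Term (! X) 𝟙
  e = gen N.eᵍ

  -- The only crossing inside `τ`: up to functoriality `τ` is `α · (ι ⊗ κ) · α⁻`, so coherence for
  -- `τ` reduces to that of this exchange.
  κ : Term (X ⊗ (Y ⊗ Z)) (Y ⊗ (X ⊗ Z))
  κ = α⁻ · (s ⊗ ι) · α

  τ : Term ((A ⊗ B) ⊗ (C ⊗ D)) ((A ⊗ C) ⊗ (B ⊗ D))
  τ = α · (ι ⊗ α⁻) · (ι ⊗ (s ⊗ ι)) · (ι ⊗ α) · α⁻

  pentagon : α {A ⊗ B} {C} {D} · α ≋ (α ⊗ ι) · α · (ι ⊗ α)
  pentagon = ≋-intro 𝕏.pentagon

  triangle : (r ⊗ ι) · α ≋ ι {X} ⊗ l {Y}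
  triangle = ≋-intro 𝕏.triangle

  hexagon : α · s · α ≋ (s {A} {C} ⊗ ι {B}) · α · (ι ⊗ s)
  hexagon = ≋-intro 𝕏.hexagon

  -- Kelly's unit coherence. Tensoring with `𝟙` on the left is faithful because `l` is a natural
  -- isomorphism, and after tensoring, pentagon and triangle suffice.
  l-⊗ : (l {X} ⊗ ι {Y}) · α ≋ l
  l-⊗ = chain (l · ⟪ whiskered ⟫ · l⁻ ⨾ done)
    where
    whiskered : ι {𝟙} ⊗ ((l {X} ⊗ ι {Y}) · α) ≋ ι ⊗ l
    whiskered = chain
      ( α⁻ · (⟪ triangle ⟫⁻ ⊗ ι) · α · (ι ⊗ α)
      ⨾ α⁻ · ((r ⊗ ι) ⊗ ι) · ⟪ pentagon ⟫⁻
      ⨾ ⟪ triangle ⟫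
      ⨾ done )

  r-⊗ : r · α ≋ ι {X} ⊗ r {Y}
  r-⊗ = chain (r · ⟪ whiskered ⟫ · r⁻ ⨾ done)
    where
    whiskered : (r · α) ⊗ ι {𝟙} ≋ (ι {X} ⊗ r {Y}) ⊗ ι
    whiskered = chain
      ( (r ⊗ ι) · ⟪ pentagon ⟫⁻ · (ι ⊗ α⁻) · α⁻
      ⨾ ⟪ triangle ⟫ · α · (ι ⊗ α⁻) · α⁻
      ⨾ α · (ι ⊗ ⟪ triangle ⟫⁻) · (ι ⊗ α⁻) · α⁻
      ⨾ done )

  -- The normaliser is not confluent here: cancelling l⁻ · l first leaves ι ⊗ l, using naturality of l first leaves l.
  l-𝟙⊗ : ι ⊗ l {X} ≋ l
  l-𝟙⊗ = chain (⟪ ≋-intro {f = (l⁻ · l) · (ι ⊗ l)} {l⁻ · l · (ι ⊗ l)} 𝕏.assoc ⟫ ⨾ done)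

  l≋r : l {𝟙} ≋ r
  l≋r = chain (r · ⟪ whiskered ⟫ · r⁻ ⨾ done)
    where
    whiskered : l {𝟙} ⊗ ι {𝟙} ≋ r ⊗ ι
    whiskered = chain
      ( ⟪ l-⊗ ⟫ · α⁻
      ⨾ ⟪ l-𝟙⊗ ⟫⁻ · α⁻
      ⨾ ⟪ triangle ⟫⁻ · α⁻
      ⨾ done )

  r-s : r · s ≋ l {X}
  r-s = chain (l · ⟪ whiskered ⟫⁻ · l⁻ ⨾ done)
    where
    whiskered : ι {𝟙} ⊗ l {X} ≋ ι ⊗ (r · s)
    whiskered = chain
      ( ⟪ triangle ⟫⁻
      ⨾ s · ⟪ r-⊗ ⟫⁻ · s · α
      ⨾ s · r · ⟪ hexagon ⟫
      ⨾ ⟪ r-⊗ ⟫ · (ι ⊗ s)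
      ⨾ done )

  l-s : l · s ≋ r {X}
  l-s = chain (⟪ r-s ⟫⁻ · s ⨾ done)

  pentagon⁻ : α⁻ · α⁻ {A ⊗ B} {C} {D} ≋ (ι ⊗ α⁻) · α⁻ · (α⁻ ⊗ ι)
  pentagon⁻ = chain ((ι ⊗ α⁻) · α⁻ · (α⁻ ⊗ ι) · ⟪ pentagon ⟫⁻ · α⁻ · α⁻ ⨾ done)

  pentagonˡ : α⁻ · (α ⊗ ι) ≋ α {A} {B} {C ⊗ D} · (ι ⊗ α⁻) · α⁻
  pentagonˡ = chain (α⁻ · ⟪ pentagon ⟫⁻ · (ι ⊗ α⁻) · α⁻ ⨾ done)

  pentagonʳ : (α⁻ ⊗ ι) · α ≋ α · (ι ⊗ α) · α⁻ {A} {B} {C ⊗ D}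
  pentagonʳ = chain ((α⁻ ⊗ ι) · ⟪ pentagon ⟫ · α⁻ ⨾ done)

  hexagon⁻ : α⁻ · s · α⁻ ≋ (ι {A} ⊗ s {C} {B}) · α⁻ · (s ⊗ ι)
  hexagon⁻ = chain ((ι ⊗ s) · α⁻ · (s ⊗ ι) · ⟪ hexagon ⟫⁻ · α⁻ · s · α⁻ ⨾ done)

  -- The hexagon in exchange form: moving `C` past `A ⊗ B` is moving it past `B` and then past `A`.
  κ-⊗ˡ : κ · α ≋ (ι ⊗ α) · κ · (ι {A} ⊗ κ {B} {C} {D})
  κ-⊗ˡ = chain
    ( α⁻ · (s ⊗ ι) · ⟪ pentagon ⟫
    ⨾ α⁻ · (α⁻ ⊗ ι) · (⟪ hexagon ⟫ ⊗ ι) · α · (ι ⊗ α)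
    ⨾ (ι ⊗ α) · ⟪ pentagon⁻ ⟫⁻ · (((s ⊗ ι) · α · (ι ⊗ s)) ⊗ ι) · α · (ι ⊗ α)
    ⨾ (ι ⊗ α) · α⁻ · (s ⊗ ι) · α⁻ · ⟪ pentagon ⟫⁻ · (ι ⊗ α⁻) · (ι ⊗ (s ⊗ ι)) · (ι ⊗ α)
    ⨾ done )

  κ-⊗ʳ : κ · (ι ⊗ α) ≋ α · (ι ⊗ κ) · κ {A} {B} {C ⊗ D}
  κ-⊗ʳ = chain (α · (ι ⊗ κ) · κ · (ι ⊗ α⁻) · ⟪ κ-⊗ˡ ⟫⁻ · α⁻ · κ · (ι ⊗ α) ⨾ done)

  κ-⊗ : (κ ⊗ ι) · α · (ι ⊗ α) ≋ α · (ι ⊗ α) · κ {A} {B} {C ⊗ D}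
  κ-⊗ = chain
    ( ((α⁻ · (s ⊗ ι)) ⊗ ι) · ⟪ pentagon ⟫⁻
    ⨾ α · (ι ⊗ α) · ⟪ pentagon⁻ ⟫⁻ · ((s ⊗ ι) ⊗ ι) · α · α
    ⨾ done )

  κ-unitˡ : (ι ⊗ l) · κ ≋ l {X ⊗ Y}
  κ-unitˡ = chain
    ( ⟪ triangle ⟫⁻ · κ
    ⨾ (⟪ r-s ⟫ ⊗ ι) · α
    ⨾ ⟪ l-⊗ ⟫
    ⨾ done )

  κ-unitʳ : l · κ ≋ ι {X} ⊗ l {Y}
  κ-unitʳ = chain (⟪ κ-unitˡ ⟫⁻ · κ ⨾ done)

  s-⊗ʳ : s ≋ α · (ι ⊗ s) · κ {A} {B} {C}
  s-⊗ʳ = chain (α · ⟪ hexagon⁻ ⟫ · α ⨾ done)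

  s-⊗ˡ : s · α ≋ κ · (ι {A} ⊗ s {B} {C})
  s-⊗ˡ = chain (α⁻ · ⟪ hexagon ⟫ ⨾ done)

  τ-σ : s · τ ≋ τ · (s {A} {B} ⊗ s {C} {D})
  τ-σ = chain
    ( ⟪ s-⊗ʳ ⟫ · τ
    ⨾ α · (ι ⊗ s) · ⟪ κ-⊗ˡ ⟫ · α⁻ · τ
    ⨾ α · (ι ⊗ ⟪ s-⊗ˡ ⟫) · α⁻ · (s ⊗ ι)
    ⨾ done )

  -- Both sides perform the same permutation of six factors. Comonoidality of `μ` rests on this
  -- equation, and coassociativity of `n` on its conjugate by the involution `τ`.
  τ-assoc : (α ⊗ α) · τ · (ι {A ⊗ A′} ⊗ τ {B} {B′} {C} {C′}) ≋ τ · (τ ⊗ ι) · α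
  τ-assoc = chain
    ( ⟪ pentagon ⟫⁻ · (ι ⊗ α⁻) · (ι ⊗ (ι ⊗ α)) · (ι ⊗ κ) · α⁻ · (ι ⊗ τ)
    ⨾ α · α · (ι ⊗ (α⁻ · (ι ⊗ α) · ⟪ κ-⊗ʳ ⟫ · (ι ⊗ ((ι ⊗ κ) · α⁻)))) · α⁻
    ⨾ α · α · (ι ⊗ ((ι ⊗ ⟪ κ-⊗ˡ ⟫⁻) · κ · (ι ⊗ α⁻))) · α⁻
    ⨾ α · α · (ι ⊗ ((ι ⊗ κ) · α⁻ · ⟪ κ-⊗ ⟫⁻ · (ι ⊗ α⁻))) · α⁻
    ⨾ α · (ι ⊗ κ) · ⟪ pentagonˡ ⟫⁻ · α · (ι ⊗ (κ ⊗ ι)) · (ι ⊗ α) · α⁻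
    ⨾ α · (ι ⊗ κ) · α⁻ · ((α · (ι ⊗ κ)) ⊗ ι) · ⟪ pentagonʳ ⟫⁻
    ⨾ done )

  τ-assoc⁻ : α · (ι ⊗ τ) · τ ≋ (τ ⊗ ι) · τ · (α {A} {B} {C} ⊗ α {A′} {B′} {C′})
  τ-assoc⁻ = chain ((τ ⊗ ι) · τ · ⟪ τ-assoc ⟫⁻ · (ι ⊗ τ) · τ ⨾ done)

  τ-unit : (l ⊗ l) · τ {𝟙} {𝟙} {X} {Y} ≋ l · (l ⊗ ι)
  τ-unit = chain
    ( ⟪ l-⊗ ⟫ · (ι ⊗ ((ι ⊗ l) · κ)) · α⁻
    ⨾ l · (ι ⊗ ⟪ κ-unitˡ ⟫) · α⁻
    ⨾ l · ⟪ triangle ⟫⁻ · α⁻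
    ⨾ l · (⟪ l≋r ⟫⁻ ⊗ ι)
    ⨾ done )

  τ-𝟙 : (r ⊗ ι) · τ {A} {B} {𝟙} {X} ≋ α⁻ · (ι ⊗ l)
  τ-𝟙 = chain
    ( ⟪ triangle ⟫ · (ι ⊗ κ) · α⁻
    ⨾ (ι ⊗ ⟪ κ-unitʳ ⟫) · α⁻
    ⨾ done )

  m-assoc : m · (m ⊗ ι) · α ≋ ! α · m {A} {B ⊗ C} · (ι ⊗ m)
  m-assoc = ≋-intro 𝕏.m-assoc

  m-σ : m · s ≋ ! s · m {A} {B}
  m-σ = ≋-intro 𝕏.m-symmetric

  m-κ : m · (ι ⊗ m) · κ ≋ ! κ · m · (ι { ! A} ⊗ m {B} {C})
  m-κ = chain
    ( ! α⁻ · ⟪ m-assoc ⟫⁻ · κ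
    ⨾ ! α⁻ · m · (⟪ m-σ ⟫ ⊗ ι) · α
    ⨾ ! α⁻ · ! (s ⊗ ι) · ⟪ m-assoc ⟫
    ⨾ done )

  m-τ : ! τ · m · (m ⊗ m) ≋ m · (m {A} {B} ⊗ m {C} {D}) · τ
  m-τ = chain
    ( ! (α · (ι ⊗ κ) · α⁻) · ⟪ m-assoc ⟫ · α⁻ · (ι ⊗ m)
    ⨾ ! α · m · (ι ⊗ ⟪ m-κ ⟫⁻) · α⁻
    ⨾ ⟪ m-assoc ⟫⁻ · (ι ⊗ ((ι ⊗ m) · κ)) · α⁻
    ⨾ done )


  δ-coassoc : δ · δ ≋ ! δ · δ {A}
  δ-coassoc = ≋-intro 𝕏.comonad-assoc

  εδ : ε · δ {A} ≋ ι
  εδ = ≋-intro 𝕏.comonad-idˡ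

  m-unitˡ : ! l · m · (mK ⊗ ι) ≋ l { ! A}
  m-unitˡ = ≋-intro 𝕏.m-unitˡ

  m-unitʳ : ! r · m · (ι ⊗ mK) ≋ r { ! A}
  m-unitʳ = ≋-intro 𝕏.m-unitʳ

  δ-m : δ · m {A} {B} ≋ ! m · m · (δ ⊗ δ)
  δ-m = ≋-intro 𝕏.δ-m

  δ-mK : δ · mK ≋ ! mK · mK
  δ-mK = ≋-intro 𝕏.δ-mK

  ε-m : ε · m {A} {B} ≋ ε ⊗ ε
  ε-m = ≋-intro 𝕏.ε-m

  ε-mK : ε · mK ≋ ι
  ε-mK = ≋-intro 𝕏.ε-mK

  Δ-coassoc : α · (ι ⊗ Δ) · Δ {A} ≋ (Δ ⊗ ι) · Δ
  Δ-coassoc = ≋-intro 𝕏.Δ-coassoc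

  Δ-counitˡ : l · (e ⊗ ι) · Δ {A} ≋ ι
  Δ-counitˡ = ≋-intro 𝕏.Δ-counitˡ

  Δ-counitʳ : r · (ι ⊗ e) · Δ {A} ≋ ι
  Δ-counitʳ = ≋-intro 𝕏.Δ-counitʳ

  Δ-cocomm : s · Δ {A} ≋ Δ
  Δ-cocomm = ≋-intro 𝕏.Δ-cocomm

  Δδ : Δ · δ {A} ≋ (δ ⊗ δ) · Δ
  Δδ = ≋-intro 𝕏.δ-Δ

  eδ : e · δ {A} ≋ e
  eδ = ≋-intro 𝕏.δ-e

  Δ-m : Δ · m {A} {B} ≋ (m ⊗ m) · τ · (Δ ⊗ Δ)
  Δ-m = ≋-intro 𝕏.Δ-m

  e-m : e · m {A} {B} ≋ l · (e ⊗ e)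
  e-m = ≋-intro 𝕏.e-m

  Δ-mK : Δ · mK ≋ (mK ⊗ mK) · l⁻
  Δ-mK = ≋-intro 𝕏.Δ-mK

  e-mK : e · mK ≋ ι
  e-mK = ≋-intro 𝕏.e-mK

  !Δδ : ! Δ · δ {A} ≋ m · (δ ⊗ δ) · Δ
  !Δδ = ≋-intro 𝕏.!Δ-δ

  !eδ : ! e · δ {A} ≋ mK · e
  !eδ = ≋-intro 𝕏.!e-δ

-- The Hopf monoid structure on `!A`.

module Bialgebra {o h ℓe} (𝕏 : LinearCategory o h ℓe) (Add : AdditiveWithNegatives 𝕏) (A : LinearCategory.Obj 𝕏) where
  open Terms 𝕏
  open LinearCategory 𝕏 using (cat; _≈_; _∘_; id; !₁; !-∘; !-resp-≈; assoc; identityˡ; comonad-idʳ)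
  open AdditiveWithNegatives Add
  open HomReasoning cat
  private
    module 𝕏 = LinearCategory 𝕏
    module C = Construction 𝕏 Add A

  a H : Ob
  a = ` A
  H = ! a

  π₁ π₂ : Term (H ⊗ H) a
  π₁ = r · (ε ⊗ e)
  π₂ = l · (e ⊗ ε)

  ad : (H ⊗ H) ⟶ a
  ad = ⟦ π₁ ⟧ + ⟦ π₂ ⟧

  zero : 𝟙 ⟶ a
  zero = 0h

  -- ∇ and u are kept as atoms, so that the normaliser does not push structure maps into their definitions.
  ∇ : Term (H ⊗ H) H
  ∇ = atom C.∇

  u : Term 𝟙 H
  u = atom C.u

  private
    ∇-def : ∇ ≋ ! atom ad · m · (δ ⊗ δ)
    ∇-def = ≋-intro ≈-refl

    u-def : u ≋ ! atom zero · mK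
    u-def = ≋-intro ≈-refl

  -- Every map of the form `! f · m · (δ ⊗ δ)` respects the coalgebra structures, by naturality,
  -- `δ-m` and coassociativity of `δ`.
  δ∇ : δ · ∇ ≋ ! ∇ · m · (δ ⊗ δ)
  δ∇ = chain
    ( δ · ⟪ ∇-def ⟫
    ⨾ ! ! atom ad · ⟪ δ-m ⟫ · (δ ⊗ δ)
    ⨾ ! ! atom ad · ! m · m · (⟪ δ-coassoc ⟫ ⊗ ⟪ δ-coassoc ⟫)
    ⨾ ! ⟪ ∇-def ⟫⁻ · m · (δ ⊗ δ)
    ⨾ done )

  ε∇ : ε · ∇ ≋ atom ad
  ε∇ = chain
    ( ε · ⟪ ∇-def ⟫
    ⨾ atom ad · ⟪ ε-m ⟫ · (δ ⊗ δ)
    ⨾ atom ad · (⟪ εδ ⟫ ⊗ ⟪ εδ ⟫)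
    ⨾ done )

  e∇ : e · ∇ ≋ l · (e ⊗ e)
  e∇ = chain
    ( e · ⟪ ∇-def ⟫
    ⨾ ⟪ e-m ⟫ · (δ ⊗ δ)
    ⨾ l · (⟪ eδ ⟫ ⊗ ⟪ eδ ⟫)
    ⨾ done )

  Δ∇ : Δ · ∇ ≋ (∇ ⊗ ∇) · τ · (Δ ⊗ Δ)
  Δ∇ = chain
    ( Δ · ⟪ ∇-def ⟫
    ⨾ (! atom ad ⊗ ! atom ad) · ⟪ Δ-m ⟫ · (δ ⊗ δ)
    ⨾ (! atom ad ⊗ ! atom ad) · (m ⊗ m) · τ · (⟪ Δδ ⟫ ⊗ ⟪ Δδ ⟫)
    ⨾ (⟪ ∇-def ⟫⁻ ⊗ ⟪ ∇-def ⟫⁻) · τ · (Δ ⊗ Δ)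
    ⨾ done )

  δu : δ · u ≋ ! u · mK
  δu = chain
    ( δ · ⟪ u-def ⟫
    ⨾ ! ! atom zero · ⟪ δ-mK ⟫
    ⨾ ! ⟪ u-def ⟫⁻ · mK
    ⨾ done )

  εu : ε · u ≋ atom zero
  εu = chain
    ( ε · ⟪ u-def ⟫
    ⨾ atom zero · ⟪ ε-mK ⟫
    ⨾ done )

  eu : e · u ≋ ι
  eu = chain (e · ⟪ u-def ⟫ ⨾ ⟪ e-mK ⟫ ⨾ done)

  Δu : Δ · u ≋ (u ⊗ u) · l⁻
  Δu = chain
    ( Δ · ⟪ u-def ⟫
    ⨾ (! atom zero ⊗ ! atom zero) · ⟪ Δ-mK ⟫
    ⨾ (⟪ u-def ⟫⁻ ⊗ ⟪ u-def ⟫⁻) · l⁻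
    ⨾ done )

  -- The counit law `!₁ ε ∘ δ ≈ id` forces any `k` that intertwines `c` with `δ` to equal
  -- `!₁ (ε ∘ k) ∘ c`.
  cofree-unique : ∀ {X} {c : Term X (! X)} {f g : Term X H} →
    δ · f ≋ ! f · c → δ · g ≋ ! g · c → ε · f ≋ ε · g → f ≋ g
  cofree-unique {c = c} {f} {g} δf δg εfg = ≋-intro (begin
    ⟦ f ⟧                   ≈⟨ mediate f δf ⟩
    !₁ (𝕏.ε ∘ ⟦ f ⟧) ∘ ⟦ c ⟧  ≈⟨ !-resp-≈ (eq εfg) ⟩∘⟨refl ⟩
    !₁ (𝕏.ε ∘ ⟦ g ⟧) ∘ ⟦ c ⟧  ≈⟨ mediate g δg ⟨
    ⟦ g ⟧                   ∎)
    where
    mediate : ∀ k → δ · k ≋ ! k · c → ⟦ k ⟧ ≈ !₁ (𝕏.ε ∘ ⟦ k ⟧) ∘ ⟦ c ⟧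
    mediate k δk = begin
      ⟦ k ⟧                           ≈⟨ identityˡ ⟨
      id ∘ ⟦ k ⟧                      ≈⟨ comonad-idʳ ⟩∘⟨refl ⟨
      (!₁ 𝕏.ε ∘ 𝕏.δ) ∘ ⟦ k ⟧          ≈⟨ assoc ⟩
      !₁ 𝕏.ε ∘ (𝕏.δ ∘ ⟦ k ⟧)          ≈⟨ refl⟩∘⟨ eq δk ⟩
      !₁ 𝕏.ε ∘ (!₁ ⟦ k ⟧ ∘ ⟦ c ⟧)     ≈⟨ pullˡ (≈-sym !-∘) ⟩
      !₁ (𝕏.ε ∘ ⟦ k ⟧) ∘ ⟦ c ⟧        ∎

  infixl 6 _⊕_
  -- A sum is an atom to the normaliser, so bilinearity enters only through explicit rules.
  _⊕_ : ∀ {X Y} → Term X Y → Term X Y → Term X Y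
  f ⊕ g = atom (⟦ f ⟧ + ⟦ g ⟧)

  ⊕-cong : ∀ {X Y} {f f′ g g′ : Term X Y} → f ≋ f′ → g ≋ g′ → f ⊕ g ≋ f′ ⊕ g′
  ⊕-cong p q = ≋-intro (+-resp-≈ (eq p) (eq q))

  ⊕-assoc : ∀ {X Y} (f g k : Term X Y) → (f ⊕ g) ⊕ k ≋ f ⊕ (g ⊕ k)
  ⊕-assoc f g k = ≋-intro +-assoc

  ⊕-· : ∀ {X Y Z} (f g : Term Y Z) (k : Term X Y) → (f ⊕ g) · k ≋ f · k ⊕ g · k
  ⊕-· f g k = ≋-intro ∘-distribʳ

  ⊕-⊗ : ∀ {X Y Z Z′ W V} (j : Term (Z ⊗ Z′) W) (f g : Term X Z) (k : Term Y Z′) (i : Term V (X ⊗ Y)) →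
        j · ((f ⊕ g) ⊗ k) · i ≋ j · (f ⊗ k) · i ⊕ j · (g ⊗ k) · i
  ⊕-⊗ j f g k i = ≋-intro (≈-trans (refl⟩∘⟨ ≈-trans (⊗-distribʳ ⟩∘⟨refl) ∘-distribʳ) ∘-distribˡ)

  ⊗-⊕ : ∀ {X Y Z Z′ W} (j : Term (Z ⊗ Z′) W) (k : Term X Z) (f g : Term Y Z′) →
        j · (k ⊗ (f ⊕ g)) ≋ j · (k ⊗ f) ⊕ j · (k ⊗ g)
  ⊗-⊕ j k f g = ≋-intro (≈-trans (refl⟩∘⟨ ⊗-distribˡ) ∘-distribˡ)

  ∇-assoc : ∇ · (ι ⊗ ∇) ≋ ∇ · (∇ ⊗ ι) · α
  -- `c` is the coalgebra structure of the threefold tensor power of `H`.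
  ∇-assoc = cofree-unique {c = m · (δ ⊗ (m · (δ ⊗ δ)))}
    (chain
      ( ⟪ δ∇ ⟫ · (ι ⊗ ∇)
      ⨾ ! ∇ · m · (δ ⊗ ⟪ δ∇ ⟫)
      ⨾ done ))
    (chain
      ( ⟪ δ∇ ⟫ · (∇ ⊗ ι) · α
      ⨾ ! ∇ · m · (⟪ δ∇ ⟫ ⊗ δ) · α
      ⨾ ! ∇ · ! (∇ ⊗ ι) · ⟪ m-assoc ⟫ · (δ ⊗ (δ ⊗ δ))
      ⨾ done ))
    (chain
      ( ⟪ ε∇ ⟫ · (ι ⊗ ∇)
      ⨾ ⟪ ⊕-· π₁ π₂ (ι ⊗ ∇) ⟫
      ⨾ ⟪ ⊕-cong left right ⟫
      ⨾ ⟪ ⊕-assoc x₁ x₂ x₃ ⟫⁻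
      ⨾ ⟪ ⊕-cong left′ right′ ⟫⁻
      ⨾ ⟪ ⊕-· π₁ π₂ ((∇ ⊗ ι) · α) ⟫⁻
      ⨾ ⟪ ε∇ ⟫⁻ · (∇ ⊗ ι) · α
      ⨾ done ))
    where
    -- The three projections to `a`, the other factors being discarded by `e`. Both bracketings of
    -- the product have their sum as image under `ε`.
    x₁ x₂ x₃ : Term (H ⊗ (H ⊗ H)) a
    x₁ = r · (ε ⊗ (l · (e ⊗ e)))
    x₂ = l · (e ⊗ π₁)
    x₃ = l · (e ⊗ π₂)

    left : π₁ · (ι ⊗ ∇) ≋ x₁
    left = chain (r · (ε ⊗ ⟪ e∇ ⟫) ⨾ done)

    right : π₂ · (ι ⊗ ∇) ≋ x₂ ⊕ x₃
    right = chain
      ( l · (e ⊗ ⟪ ε∇ ⟫)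
      ⨾ ⟪ ⊗-⊕ l e π₁ π₂ ⟫
      ⨾ done )

    left₁ : r · (π₁ ⊗ e) · α ≋ x₁
    left₁ = chain (r · ⟪ triangle ⟫ · (ε ⊗ (e ⊗ e)) ⨾ done)

    left₂ : r · (π₂ ⊗ e) · α ≋ x₂
    left₂ = chain (l · ⟪ r-⊗ ⟫ · (e ⊗ (ε ⊗ e)) ⨾ done)

    left′ : π₁ · (∇ ⊗ ι) · α ≋ x₁ ⊕ x₂
    left′ = chain
      ( r · (⟪ ε∇ ⟫ ⊗ e) · α
      ⨾ ⟪ ⊕-⊗ r π₁ π₂ e α ⟫
      ⨾ ⟪ ⊕-cong left₁ left₂ ⟫
      ⨾ done )

    right′ : π₂ · (∇ ⊗ ι) · α ≋ x₃
    right′ = chain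
      ( l · (⟪ e∇ ⟫ ⊗ ε) · α
      ⨾ l · ⟪ l-⊗ ⟫ · (e ⊗ (e ⊗ ε))
      ⨾ done )

  0ᵗ : ∀ {X Y} → Term X Y
  0ᵗ = atom 0h

  ⊕-0 : ∀ {X Y} (f : Term X Y) → f ⊕ 0ᵗ ≋ f
  ⊕-0 f = ≋-intro (≈-trans +-comm +-identityˡ)

  0-⊕ : ∀ {X Y} (f : Term X Y) → 0ᵗ ⊕ f ≋ f
  0-⊕ f = ≋-intro +-identityˡ

  ⊗-0 : ∀ {X Y Z Z′ W} (j : Term (Z ⊗ Z′) W) (k : Term X Z) → j · (k ⊗ 0ᵗ {Y}) ≋ 0ᵗ
  ⊗-0 j k = ≋-intro (≈-trans (refl⟩∘⟨ ⊗-zeroˡ) ∘-zeroˡ)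

  0-⊗ : ∀ {X Y Z Z′ W} (j : Term (Z ⊗ Z′) W) (k : Term X Z′) → j · (0ᵗ {Y} ⊗ k) ≋ 0ᵗ
  0-⊗ j k = ≋-intro (≈-trans (refl⟩∘⟨ ⊗-zeroʳ) ∘-zeroˡ)

  ∇-unitʳ : ∇ · (ι ⊗ u) ≋ r
  ∇-unitʳ = cofree-unique {c = m · (δ ⊗ mK)}
    (chain
      ( ⟪ δ∇ ⟫ · (ι ⊗ u)
      ⨾ ! ∇ · m · (δ ⊗ ⟪ δu ⟫)
      ⨾ done ))
    -- The unitor is itself a coalgebra map, by the unit law of `m`.
    (chain (⟪ m-unitʳ ⟫⁻ · (δ ⊗ ι) ⨾ done))
    (chain
      ( ⟪ ε∇ ⟫ · (ι ⊗ u)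
      ⨾ ⟪ ⊕-· π₁ π₂ (ι ⊗ u) ⟫
      ⨾ ⟪ ⊕-cong left right ⟫
      ⨾ ⟪ ⊕-0 (ε · r) ⟫
      ⨾ done ))
    where
    left : π₁ · (ι ⊗ u) ≋ ε · r
    left = chain (r · (ε ⊗ ⟪ eu ⟫) ⨾ done)

    right : π₂ · (ι ⊗ u) ≋ 0ᵗ
    right = chain (l · (e ⊗ ⟪ εu ⟫) ⨾ ⟪ ⊗-0 l e ⟫ ⨾ done)

  ∇-unitˡ : ∇ · (u ⊗ ι) ≋ l
  ∇-unitˡ = cofree-unique {c = m · (mK ⊗ δ)}
    (chain
      ( ⟪ δ∇ ⟫ · (u ⊗ ι)
      ⨾ ! ∇ · m · (⟪ δu ⟫ ⊗ δ)
      ⨾ done ))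
    (chain (⟪ m-unitˡ ⟫⁻ · (ι ⊗ δ) ⨾ done))
    (chain
      ( ⟪ ε∇ ⟫ · (u ⊗ ι)
      ⨾ ⟪ ⊕-· π₁ π₂ (u ⊗ ι) ⟫
      ⨾ ⟪ ⊕-cong left right ⟫
      ⨾ ⟪ 0-⊕ (ε · l) ⟫
      ⨾ done ))
    where
    left : π₁ · (u ⊗ ι) ≋ 0ᵗ
    left = chain (r · (⟪ εu ⟫ ⊗ e) ⨾ ⟪ 0-⊗ r e ⟫ ⨾ done)

    right : π₂ · (u ⊗ ι) ≋ ε · l
    right = chain (l · (⟪ eu ⟫ ⊗ ε) ⨾ done)

  -- Both sides are coalgebra maps out of `δ`, the left one because `!Δδ` makes `Δ` such a map.
  -- Under `ε` the counit laws leave `f ∘ ε + g ∘ ε` on either side.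
  convolution-! : (f g : a ⟶ a) → ∇ · (! atom f ⊗ ! atom g) · Δ {a} ≋ ! (atom f ⊕ atom g)
  convolution-! f g = cofree-unique {c = δ}
    (chain
      ( ⟪ δ∇ ⟫ · (! atom f ⊗ ! atom g) · Δ
      ⨾ ! ∇ · ! (! atom f ⊗ ! atom g) · ⟪ !Δδ ⟫⁻
      ⨾ done ))
    (chain done)
    (chain
      ( ⟪ ε∇ ⟫ · (! atom f ⊗ ! atom g) · Δ
      ⨾ ⟪ ⊕-· π₁ π₂ ((! atom f ⊗ ! atom g) · Δ) ⟫
      ⨾ ⟪ ⊕-cong left right ⟫
      ⨾ ⟪ ⊕-· (atom f) (atom g) ε ⟫⁻
      ⨾ done ))
    where
    left : π₁ · (! atom f ⊗ ! atom g) · Δ {a} ≋ atom f · ε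
    left = chain (atom f · ε · ⟪ Δ-counitʳ ⟫ ⨾ done)

    right : π₂ · (! atom f ⊗ ! atom g) · Δ {a} ≋ atom g · ε
    right = chain (atom g · ε · ⟪ Δ-counitˡ ⟫ ⨾ done)

  -- Identifies the zero map with the convolution unit: both sides are coalgebra maps that vanish
  -- under `ε`.
  !0 : ! 0ᵗ {a} ≋ u · e
  !0 = cofree-unique {c = δ}
    (chain done)
    (chain (⟪ δu ⟫ · e ⨾ ! u · ⟪ !eδ ⟫⁻ ⨾ done))
    (chain (⟪ ≋-intro {f = 0ᵗ · ε} {0ᵗ · e} (≈-trans ∘-zeroʳ (≈-sym ∘-zeroʳ)) ⟫ ⨾ ⟪ εu ⟫⁻ · e ⨾ done))

  neg : a ⟶ a
  neg = proj₁ (negatives id)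

  S : Term H H
  S = ! atom neg

  antipodeʳ : ∇ · (ι ⊗ S) · Δ ≋ u · e
  antipodeʳ = chain
    -- Normal forms erase identities, so the identity of `H` is reintroduced as `!` of an atom to
    -- match `convolution-!`.
    ( ∇ · (! ⟪ ≋-intro {f = ι} {atom id} ≈-refl ⟫ ⊗ S) · Δ
    ⨾ ⟪ convolution-! id neg ⟫
    ⨾ ! ⟪ ≋-intro {a} {f = atom id ⊕ atom neg} {0ᵗ} (proj₂ (negatives id)) ⟫
    ⨾ ⟪ !0 ⟫
    ⨾ done )

  antipodeˡ : ∇ · (S ⊗ ι) · Δ ≋ u · e
  antipodeˡ = chain
    ( ∇ · (S ⊗ ! ⟪ ≋-intro {f = ι} {atom id} ≈-refl ⟫) · Δ
    ⨾ ⟪ convolution-! neg id ⟫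
    ⨾ ! ⟪ ≋-intro {a} {f = atom neg ⊕ atom id} {0ᵗ} (≈-trans +-comm (proj₂ (negatives id))) ⟫
    ⨾ ⟪ !0 ⟫
    ⨾ done )

-- The lifting monad, its fusion maps and their inverses.

module Lifting {o h ℓe} (𝕏 : LinearCategory o h ℓe) (Add : AdditiveWithNegatives 𝕏) (A : LinearCategory.Obj 𝕏) where
  open Terms 𝕏
  open Bialgebra 𝕏 Add A
  open LinearCategory 𝕏 using (cat; _≈_; _∘_; ⊗-id; ⊗-∘; ⊗-resp-≈; identityˡ)
  open HomReasoning cat
  private
    module 𝕏 = LinearCategory 𝕏
    module C = Construction 𝕏 Add A
    variable
      X Y Z W : Ob

  μ : Term (H ⊗ (H ⊗ X)) (H ⊗ X)
  μ = (∇ ⊗ ι) · α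

  η : Term X (H ⊗ X)
  η = (u ⊗ ι) · l⁻

  n : Term (H ⊗ (X ⊗ Y)) ((H ⊗ X) ⊗ (H ⊗ Y))
  n = τ · (Δ ⊗ ι)

  nK : Term (H ⊗ 𝟙) 𝟙
  nK = e · r

  λL : Term (H ⊗ ! X) (! (H ⊗ X))
  λL = m · (δ ⊗ ι)

  μ-assoc : μ · (ι ⊗ μ {X}) ≋ μ · μ
  μ-assoc = chain
    ( (⟪ ∇-assoc ⟫ ⊗ ι) · α · (ι ⊗ α)
    ⨾ ((∇ · (∇ ⊗ ι)) ⊗ ι) · ⟪ pentagon ⟫⁻
    ⨾ done )

  μ-ηʳ : μ · (ι ⊗ η {X}) ≋ ι
  μ-ηʳ = chain
    ( (⟪ ∇-unitʳ ⟫ ⊗ ι) · α · (ι ⊗ l⁻)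
    ⨾ ⟪ triangle ⟫ · (ι ⊗ l⁻)
    ⨾ done )

  μ-ηˡ : μ · η ≋ ι {H ⊗ X}
  μ-ηˡ = chain
    ( (⟪ ∇-unitˡ ⟫ ⊗ ι) · α · l⁻
    ⨾ ⟪ l-⊗ ⟫ · l⁻
    ⨾ done )

  n-assoc : α · (ι ⊗ n {Y} {Z}) · n {X} ≋ (n ⊗ ι) · n · (ι ⊗ α)
  n-assoc = chain
    ( ⟪ τ-assoc⁻ ⟫ · (((ι ⊗ Δ) · Δ) ⊗ ι)
    ⨾ (τ ⊗ ι) · τ · (⟪ Δ-coassoc ⟫ ⊗ α)
    ⨾ done )

  n-unitˡ : l · (nK ⊗ ι) · n ≋ ι ⊗ l {X}
  n-unitˡ = chain
    ( l · (e ⊗ ι) · ⟪ τ-𝟙 ⟫ · (Δ ⊗ ι)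
    ⨾ ⟪ l-⊗ ⟫⁻ · α⁻ · (((e ⊗ ι) · Δ) ⊗ l)
    ⨾ ⟪ Δ-counitˡ ⟫ ⊗ l
    ⨾ done )

  n-σ : s · n ≋ n · (ι ⊗ s {X} {Y})
  n-σ = chain
    ( ⟪ τ-σ ⟫ · (Δ ⊗ ι)
    ⨾ τ · (⟪ Δ-cocomm ⟫ ⊗ s)
    ⨾ done )

  -- The left unit law transported across the symmetry, which `n` respects by cocommutativity.
  n-unitʳ : r · (ι ⊗ nK) · n ≋ ι ⊗ r {X}
  n-unitʳ = chain
    ( ⟪ l-s ⟫⁻ · (ι ⊗ nK) · n
    ⨾ l · (nK ⊗ ι) · ⟪ n-σ ⟫
    ⨾ ⟪ n-unitˡ ⟫ · (ι ⊗ s)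
    ⨾ ι ⊗ ⟪ l-s ⟫
    ⨾ done )

  n-μ : n {X} {Y} · μ ≋ (μ ⊗ μ) · n · (ι ⊗ n)
  n-μ = chain
    ( τ · (⟪ Δ∇ ⟫ ⊗ ι) · α
    ⨾ ((∇ ⊗ ι) ⊗ (∇ ⊗ ι)) · ⟪ τ-assoc ⟫⁻ · (Δ ⊗ (Δ ⊗ ι))
    ⨾ done )

  nK-μ : nK · μ ≋ nK · (ι ⊗ nK)
  nK-μ = chain
    ( ⟪ e∇ ⟫ · r · α
    ⨾ l · (e ⊗ e) · ⟪ r-⊗ ⟫
    ⨾ ⟪ l≋r ⟫ · (e ⊗ (e · r))
    ⨾ done )

  n-η : n {X} {Y} · η ≋ η ⊗ η
  n-η = chain
    ( τ · (⟪ Δu ⟫ ⊗ ι) · l⁻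
    ⨾ ((u ⊗ ι) ⊗ (u ⊗ ι)) · (l⁻ ⊗ l⁻) · ⟪ τ-unit ⟫ · (l⁻ ⊗ ι) · l⁻
    ⨾ done )

  nK-η : nK · η ≋ ι
  nK-η = chain
    ( ⟪ eu ⟫ · r · l⁻
    ⨾ ⟪ l≋r ⟫⁻ · l⁻
    ⨾ done )

  λ-μ : λL {X} · μ ≋ ! μ · λL · (ι ⊗ λL)
  λ-μ = chain
    ( m · (⟪ δ∇ ⟫ ⊗ ι) · α
    ⨾ ! (∇ ⊗ ι) · ⟪ m-assoc ⟫ · (δ ⊗ (δ ⊗ ι))
    ⨾ done )

  λ-η : λL {X} · η ≋ ! η
  λ-η = chain
    ( m · (⟪ δu ⟫ ⊗ ι) · l⁻
    ⨾ ! (u ⊗ ι) · ! l⁻ · ⟪ m-unitˡ ⟫ · l⁻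
    ⨾ done )

  λ-δ : δ · λL {X} ≋ ! λL · λL · (ι ⊗ δ)
  λ-δ = chain
    ( ⟪ δ-m ⟫ · (δ ⊗ ι)
    ⨾ ! m · m · (⟪ δ-coassoc ⟫ ⊗ δ)
    ⨾ done )

  λ-ε : ε · λL {X} ≋ ι ⊗ ε
  λ-ε = chain
    ( ⟪ ε-m ⟫ · (δ ⊗ ι)
    ⨾ ⟪ εδ ⟫ ⊗ ε
    ⨾ done )

  λ-m : ! n · λL · (ι ⊗ m {X} {Y}) ≋ m · (λL ⊗ λL) · n
  λ-m = chain
    ( ! τ · m · (⟪ !Δδ ⟫ ⊗ m)
    ⨾ ⟪ m-τ ⟫ · (((δ ⊗ δ) · Δ) ⊗ ι)
    ⨾ done )

  λ-mK : ! nK · λL · (ι ⊗ mK) ≋ mK · nK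
  λ-mK = chain
    ( ! e · ⟪ m-unitʳ ⟫ · (δ ⊗ ι)
    ⨾ ⟪ !eδ ⟫ · r
    ⨾ done )

  -- Together with `λ-e` this will make `Δ` and `e` module maps. It combines `Δ-m` with `δ` being a
  -- comonoid morphism.
  λ-Δ : Δ · λL {X} ≋ (λL ⊗ λL) · n · (ι ⊗ Δ)
  λ-Δ = chain
    ( ⟪ Δ-m ⟫ · (δ ⊗ ι)
    ⨾ (m ⊗ m) · τ · (⟪ Δδ ⟫ ⊗ Δ)
    ⨾ done )

  λ-e : e · λL {X} ≋ nK · (ι ⊗ e)
  λ-e = chain
    ( ⟪ e-m ⟫ · (δ ⊗ ι)
    ⨾ ⟪ l≋r ⟫ · (⟪ eδ ⟫ ⊗ e)
    ⨾ done )

  -- Stated over a quoted object, so that the tensor shape of carriers such as `Y ⊗ Z` and `H ⊗ X`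
  -- stays visible to the normaliser.
  record IsAction (X : Ob) (x : (H ⊗ X) ⟶ X) : Set ℓe where
    field
      action-assoc : atom {H ⊗ X} {X} x · (ι ⊗ atom {H ⊗ X} {X} x) ≋ atom {H ⊗ X} {X} x · (∇ ⊗ ι) · α
      action-unit  : atom {H ⊗ X} {X} x · (u ⊗ ι) ≋ l
  open IsAction public

  module Fusion (X : Ob) (x : (H ⊗ X) ⟶ X) (isAction : IsAction X x) where
    -- h ⊗ x ↦ h₁ ⊗ f(h₂)x
    θ : Term H H → Term (H ⊗ X) (H ⊗ X)
    θ f = (ι ⊗ (atom x · (f ⊗ ι))) · α⁻ · (Δ ⊗ ι)

    -- `θ` carries convolution to composition; this is its value at the convolution unit.
    θ-unit : θ (u · e) ≋ ι
    θ-unit = chain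
      ( (ι ⊗ ⟪ action-unit isAction ⟫) · (ι ⊗ (e ⊗ ι)) · α⁻ · (Δ ⊗ ι)
      ⨾ ⟪ triangle ⟫⁻ · α⁻ · (((ι ⊗ e) · Δ) ⊗ ι)
      ⨾ ⟪ Δ-counitʳ ⟫ ⊗ ι
      ⨾ done )

    Δ-act-coassoc : α⁻ · (Δ ⊗ ι) · α⁻ · (Δ {a} ⊗ ι) ≋ (ι ⊗ (α⁻ · (Δ ⊗ ι))) · α⁻ · (Δ ⊗ ι {X})
    Δ-act-coassoc = chain
      ( α⁻ · α⁻ · (⟪ Δ-coassoc ⟫⁻ ⊗ ι)
      ⨾ ⟪ pentagon⁻ ⟫ · ((α · (ι ⊗ Δ) · Δ) ⊗ ι)
      ⨾ done )

    -- The composite sends `h ⊗ x` to `h₁ ⊗ S(h₂)(h₃x)`. Associativity of the action gathers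
    -- `S(h₂)h₃`, which the antipode law collapses.
    θ-S : θ S · θ ι ≋ ι
    θ-S = chain
      ( (ι ⊗ (atom x · (S ⊗ atom x))) · ⟪ Δ-act-coassoc ⟫
      ⨾ (ι ⊗ (⟪ action-assoc isAction ⟫ · (S ⊗ ι) · α⁻ · (Δ ⊗ ι))) · α⁻ · (Δ ⊗ ι)
      ⨾ (ι ⊗ (atom x · (⟪ antipodeˡ ⟫ ⊗ ι))) · α⁻ · (Δ ⊗ ι)
      ⨾ ⟪ θ-unit ⟫
      ⨾ done )

    S-θ : θ ι · θ S ≋ ι
    S-θ = chain
      ( (ι ⊗ (atom x · (ι ⊗ (atom x · (S ⊗ ι))))) · ⟪ Δ-act-coassoc ⟫
      ⨾ (ι ⊗ (⟪ action-assoc isAction ⟫ · (ι ⊗ (S ⊗ ι)) · α⁻ · (Δ ⊗ ι))) · α⁻ · (Δ ⊗ ι)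
      ⨾ (ι ⊗ (atom x · (⟪ antipodeʳ ⟫ ⊗ ι))) · α⁻ · (Δ ⊗ ι)
      ⨾ ⟪ θ-unit ⟫
      ⨾ done )

  module TensorFusion (Z : Ob) (z : (H ⊗ Z) ⟶ Z) (isAction : IsAction Z z) where
    module _ {Y : Ob} where
      private
        x x′ : Term (H ⊗ (Y ⊗ Z)) (Y ⊗ Z)
        x′ = (ι ⊗ atom z) · κ
        -- An atom, so that the action stays opaque to the normaliser; `x-def` unfolds it on demand.
        x = atom ⟦ x′ ⟧

        x-def : x ≋ x′
        x-def = ≋-intro ≈-refl

        x-assoc : x · (ι ⊗ x) ≋ x · (∇ ⊗ ι) · α
        x-assoc = chain
          ( ⟪ x-def ⟫ · (ι ⊗ ⟪ x-def ⟫)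
          ⨾ (ι ⊗ ⟪ action-assoc isAction ⟫) · κ · (ι ⊗ κ)
          ⨾ (ι ⊗ (atom z · (∇ ⊗ ι))) · ⟪ κ-⊗ˡ ⟫⁻
          ⨾ ⟪ x-def ⟫⁻ · (∇ ⊗ ι) · α
          ⨾ done )

        x-unit : x · (u ⊗ ι) ≋ l
        x-unit = chain
          ( ⟪ x-def ⟫ · (u ⊗ ι)
          ⨾ (ι ⊗ ⟪ action-unit isAction ⟫) · κ
          ⨾ ⟪ κ-unitˡ ⟫
          ⨾ done )

        x-isAction : IsAction (Y ⊗ Z) ⟦ x ⟧
        x-isAction = record { action-assoc = x-assoc ; action-unit = x-unit }

        open Fusion (Y ⊗ Z) ⟦ x ⟧ x-isAction

      -- h ⊗ (y ⊗ z) ↦ (h₁ ⊗ y) ⊗ h₂z, the map θ of Y ⊗ Z with H acting on Z only.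
      φ : Term (H ⊗ (Y ⊗ Z)) ((H ⊗ Y) ⊗ Z)
      φ = (ι ⊗ atom z) · n

      -- Opaque as well: its laws are transposed from those of `φ` by the two inverse equations.
      φ⁻ : Term ((H ⊗ Y) ⊗ Z) (H ⊗ (Y ⊗ Z))
      φ⁻ = atom ⟦ θ S · α⁻ ⟧

      private
        φ-θ : φ ≋ α · θ ι
        φ-θ = chain (α · (ι ⊗ ⟪ x-def ⟫⁻) · α⁻ · (Δ ⊗ ι) ⨾ done)

        φ⁻-def : φ⁻ ≋ θ S · α⁻
        φ⁻-def = ≋-intro ≈-refl

      φ-isoˡ : φ⁻ · φ ≋ ι
      φ-isoˡ = chain (⟪ φ⁻-def ⟫ · ⟪ φ-θ ⟫ ⨾ ⟪ θ-S ⟫ ⨾ done)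

      φ-isoʳ : φ · φ⁻ ≋ ι
      φ-isoʳ = chain (⟪ φ-θ ⟫ · ⟪ φ⁻-def ⟫ ⨾ α · ⟪ S-θ ⟫ · α⁻ ⨾ done)

    φ⁻-natural : ∀ {Y Y′} (f : Y ⟶ Y′) → φ⁻ {Y′} · ((ι ⊗ atom f) ⊗ ι) ≋ (ι ⊗ (atom f ⊗ ι)) · φ⁻ {Y}
    φ⁻-natural f = chain
      ( φ⁻ · ((ι ⊗ atom f) ⊗ ι) · ⟪ φ-isoʳ ⟫⁻
      ⨾ ⟪ φ-isoˡ ⟫ · (ι ⊗ (atom f ⊗ ι)) · φ⁻
      ⨾ done )

    -- For `φ` the corresponding law is `n-μ` combined with associativity of the action on `Z`. In
    -- this transposed form it yields associativity of the internal hom action.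
    φ⁻-μ : φ⁻ · (μ {Y} ⊗ ι) ≋ μ · (ι ⊗ φ⁻) · φ⁻
    φ⁻-μ = chain
      ( φ⁻ · (μ ⊗ ι) · ⟪ φ-isoʳ ⟫⁻
      ⨾ φ⁻ · (μ ⊗ ι) · φ · (ι ⊗ ⟪ φ-isoʳ ⟫⁻) · φ⁻
      ⨾ φ⁻ · (μ ⊗ ⟪ action-assoc isAction ⟫) · n · (ι ⊗ n) · (ι ⊗ φ⁻) · φ⁻
      ⨾ φ⁻ · (ι ⊗ atom z) · ⟪ n-μ ⟫⁻ · (ι ⊗ φ⁻) · φ⁻
      ⨾ ⟪ φ-isoˡ ⟫ · μ · (ι ⊗ φ⁻) · φ⁻
      ⨾ done )

    φ⁻-η : φ⁻ · (η {Y} ⊗ ι) ≋ η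
    φ⁻-η = chain
      ( φ⁻ · (η ⊗ (⟪ action-unit isAction ⟫⁻ · l⁻))
      ⨾ φ⁻ · (ι ⊗ atom z) · ⟪ n-η ⟫⁻
      ⨾ ⟪ φ-isoˡ ⟫ · η
      ⨾ done )

  private
    μ-unit : μ {X} · (u ⊗ ι) ≋ l
    μ-unit = chain (⟪ μ-ηˡ ⟫ · l ⨾ done)

    μ-isAction : IsAction (H ⊗ X) ⟦ μ {X} ⟧
    μ-isAction {X} = record
      -- Rewrapped because `μ` and `atom ⟦ μ ⟧` are distinct terms denoting the same map.
      { action-assoc = ≋-intro (eq (μ-assoc {X}))
      ; action-unit = ≋-intro (eq (μ-unit {X})) }

    module Free (X : Ob) = TensorFusion (H ⊗ X) ⟦ μ {X} ⟧ μ-isAction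

  fusionˡ : Term (H ⊗ (Y ⊗ (H ⊗ Z))) ((H ⊗ Y) ⊗ (H ⊗ Z))
  fusionˡ = (ι ⊗ μ) · n

  fusionˡ⁻ : Term ((H ⊗ Y) ⊗ (H ⊗ Z)) (H ⊗ (Y ⊗ (H ⊗ Z)))
  fusionˡ⁻ {Z = Z} = Free.φ⁻ Z

  fusionˡ-isoˡ : fusionˡ⁻ · fusionˡ {Y} {Z} ≋ ι
  fusionˡ-isoˡ {Y} {Z} = ≋-intro (eq (Free.φ-isoˡ Z {Y}))

  fusionˡ-isoʳ : fusionˡ · fusionˡ⁻ {Y} {Z} ≋ ι
  fusionˡ-isoʳ {Y} {Z} = ≋-intro (eq (Free.φ-isoʳ Z {Y}))

  fusionʳ : Term (H ⊗ ((H ⊗ Y) ⊗ Z)) ((H ⊗ Y) ⊗ (H ⊗ Z))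
  fusionʳ = (μ ⊗ ι) · n

  fusionʳ⁻ : Term ((H ⊗ Y) ⊗ (H ⊗ Z)) (H ⊗ ((H ⊗ Y) ⊗ Z))
  fusionʳ⁻ = (ι ⊗ s) · fusionˡ⁻ · s

  private
    -- Symmetry of `n` reduces the right Hopf condition to the left one.
    fusionʳ-fusionˡ : fusionʳ {Y} {Z} ≋ s · fusionˡ · (ι ⊗ s)
    fusionʳ-fusionˡ = chain (s · (ι ⊗ μ) · ⟪ n-σ ⟫ ⨾ done)

  fusionʳ-isoˡ : fusionʳ⁻ · fusionʳ {Y} {Z} ≋ ι
  fusionʳ-isoˡ = chain (fusionʳ⁻ · ⟪ fusionʳ-fusionˡ ⟫ ⨾ (ι ⊗ s) · ⟪ fusionˡ-isoˡ ⟫ · (ι ⊗ s) ⨾ done)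

  fusionʳ-isoʳ : fusionʳ · fusionʳ⁻ {Y} {Z} ≋ ι
  fusionʳ-isoʳ = chain (⟪ fusionʳ-fusionˡ ⟫ · fusionʳ⁻ ⨾ s · ⟪ fusionˡ-isoʳ ⟫ · s ⨾ done)

  isMELLLiftingMonad : IsMELLLiftingMonad 𝕏 C.T₀ C.T₁ C.μ C.η C.n C.nK C.λL
  isMELLLiftingMonad = record
    { T-id = ⊗-id
    ; T-∘ = ≈-trans (⊗-resp-≈ (≈-sym identityˡ) ≈-refl) ⊗-∘
    ; T-resp-≈ = ⊗-resp-≈ ≈-refl
    ; μ-natural = λ {X} {Y} {f} → eq (chain {f = (ι ⊗ atom {` X} {` Y} f) · μ} {μ · (ι ⊗ (ι ⊗ atom f))} done)
    ; η-natural = λ {X} {Y} {f} → eq (chain {f = (ι ⊗ atom {` X} {` Y} f) · η} {η · atom f} done)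
    ; monad-assoc = λ {X} → eq (μ-assoc {` X})
    ; monad-idˡ = λ {X} → eq (μ-ηʳ {` X})
    ; monad-idʳ = λ {X} → eq (μ-ηˡ {` X})
    ; n-natural = λ {X} {Y} {Z} {W} {f} {g} →
        eq (chain {f = ((ι ⊗ atom {` X} {` Y} f) ⊗ (ι ⊗ atom {` Z} {` W} g)) · n} {n · (ι ⊗ (atom f ⊗ atom g))} done)
    ; n-assoc = λ {X} {Y} {Z} → eq (n-assoc {` Y} {` Z} {` X})
    ; n-unitˡ = λ {X} → eq (n-unitˡ {` X})
    ; n-unitʳ = λ {X} → eq (n-unitʳ {` X})
    ; n-symmetric = λ {X} {Y} → eq (n-σ {` X} {` Y})
    ; μ-n = λ {X} {Y} → eq (n-μ {` X} {` Y})
    ; μ-nK = eq nK-μ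
    ; η-n = λ {X} {Y} → eq (n-η {` X} {` Y})
    ; η-nK = eq nK-η
    ; hopfˡ = λ {X} {Y} → record
        { inv = ⟦ fusionˡ⁻ {` X} {` Y} ⟧ ; isoˡ = eq (fusionˡ-isoˡ {` X} {` Y}) ; isoʳ = eq (fusionˡ-isoʳ {` X} {` Y}) }
    ; hopfʳ = λ {X} {Y} → record
        { inv = ⟦ fusionʳ⁻ {` X} {` Y} ⟧ ; isoˡ = eq (fusionʳ-isoˡ {` X} {` Y}) ; isoʳ = eq (fusionʳ-isoʳ {` X} {` Y}) }
    ; λ-natural = λ {X} {Y} {f} →
        eq (chain {f = ! (ι ⊗ atom {` X} {` Y} f) · λL} {λL · (ι ⊗ ! atom f)} done)
    ; λ-μ = λ {X} → eq (λ-μ {` X})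
    ; λ-η = λ {X} → eq (λ-η {` X})
    ; λ-δ = λ {X} → eq (λ-δ {` X})
    ; λ-ε = λ {X} → eq (λ-ε {` X})
    ; λ-m = λ {X} {Y} → eq (λ-m {` X} {` Y})
    ; λ-mK = eq λ-mK
    }

-- The linear structure on modules.

module Modules {o h ℓe} (𝕏 : LinearCategory o h ℓe) (Add : AdditiveWithNegatives 𝕏) (A : LinearCategory.Obj 𝕏) where
  open Terms 𝕏
  open Bialgebra 𝕏 Add A using (H; ∇; u)
  open Lifting 𝕏 Add A
  open LinearCategory 𝕏 using (cat; _⇒_; _≈_; _∘_; _⊗₀_; _⊗₁_; !₀; !₁; id; K; ⊗-id; ⊗-∘; ⊗-resp-≈; [_,_]₀; curry; curry-β; curry-unique)
  open HomReasoning cat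
  open Construction 𝕏 Add A using (Module; ModuleHom; MOD; HasStandardTensor; carrier; act; act-assoc; act-unit; hom; commutes)
  private
    module 𝕏 = LinearCategory 𝕏
    variable
      P Q R P′ Q′ : Module

  ∣_∣ : Module → Ob
  ∣ P ∣ = ` carrier P

  actᵗ : (P : Module) → Term (H ⊗ ∣ P ∣) ∣ P ∣
  actᵗ P = atom (act P)

  homᵗ : ModuleHom P Q → Term ∣ P ∣ ∣ Q ∣
  homᵗ f = atom (hom f)

  assocᵗ : (P : Module) → actᵗ P · (ι ⊗ actᵗ P) ≋ actᵗ P · (∇ ⊗ ι) · α
  assocᵗ P = ≋-intro (act-assoc P)

  unitᵗ : (P : Module) → actᵗ P · (u ⊗ ι) ≋ l
  unitᵗ P = ≋-intro (act-unit P)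

  isAction : (P : Module) → IsAction ∣ P ∣ (act P)
  isAction P = record { action-assoc = assocᵗ P ; action-unit = unitᵗ P }

  commutesᵗ : (f : ModuleHom P Q) → homᵗ f · actᵗ P ≋ actᵗ Q · (ι ⊗ homᵗ f)
  commutesᵗ f = ≋-intro (commutes f)

  module _ (P Q : Module) where
    private
      p : Term (H ⊗ ∣ P ∣) ∣ P ∣
      p = actᵗ P
      q : Term (H ⊗ ∣ Q ∣) ∣ Q ∣
      q = actᵗ Q

    tensor-act : Term (H ⊗ (∣ P ∣ ⊗ ∣ Q ∣)) (∣ P ∣ ⊗ ∣ Q ∣)
    tensor-act = (p ⊗ q) · n

    -- abstract: unification of tensor modules would otherwise unfold these proofs.
    abstract
      tensor-assoc : tensor-act · (ι ⊗ tensor-act) ≋ tensor-act · (∇ ⊗ ι) · α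
      tensor-assoc = chain
        ( (⟪ assocᵗ P ⟫ ⊗ ⟪ assocᵗ Q ⟫) · n · (ι ⊗ n)
        ⨾ (p ⊗ q) · ⟪ n-μ ⟫⁻
        ⨾ done )

      tensor-unit : tensor-act · (u ⊗ ι) ≋ l
      tensor-unit = chain
        ( (p ⊗ q) · ⟪ n-η ⟫ · l
        ⨾ (⟪ unitᵗ P ⟫ ⊗ ⟪ unitᵗ Q ⟫) · (l⁻ ⊗ l⁻) · l
        ⨾ done )

    tensor : Module
    tensor = record
      { carrier = carrier P ⊗₀ carrier Q
      ; act = ⟦ tensor-act ⟧
      ; act-assoc = eq tensor-assoc
      ; act-unit = eq tensor-unit }

  unit-module : Module
  unit-module = record
    { carrier = K
    ; act = ⟦ nK ⟧
    ; act-assoc = ≈-sym (eq nK-μ)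
    ; act-unit = eq (chain {f = nK · (u ⊗ ι)} {l} (⟪ nK-η ⟫ · l ⨾ done)) }

  -- The lifting of `!` along the distributive law `λL`; the module laws are `λ-μ` and `λ-η`.
  bang-act : (P : Module) → Term (H ⊗ ! ∣ P ∣) (! ∣ P ∣)
  bang-act P = ! actᵗ P · λL

  abstract
    bang-assoc : (P : Module) → bang-act P · (ι ⊗ bang-act P) ≋ bang-act P · (∇ ⊗ ι) · α
    bang-assoc P = chain
      ( ! ⟪ assocᵗ P ⟫ · λL · (ι ⊗ λL)
      ⨾ ! actᵗ P · ⟪ λ-μ ⟫⁻
      ⨾ done )

    bang-unit : (P : Module) → bang-act P · (u ⊗ ι) ≋ l
    bang-unit P = chain
      ( ! actᵗ P · ⟪ λ-η ⟫ · l
      ⨾ ! (⟪ unitᵗ P ⟫ · l⁻) · l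
      ⨾ done )

  bang-module : Module → Module
  bang-module P = record
    { carrier = !₀ (carrier P)
    ; act = ⟦ bang-act P ⟧
    ; act-assoc = eq (bang-assoc P)
    ; act-unit = eq (bang-unit P) }

  module _ (P Q : Module) where
    private
      p : Term (H ⊗ ∣ P ∣) ∣ P ∣
      p = actᵗ P
      q : Term (H ⊗ ∣ Q ∣) ∣ Q ∣
      q = actᵗ Q
      E : Ob
      E = ` [ carrier P , carrier Q ]₀

    open TensorFusion ∣ P ∣ (act P) (isAction P)

    ev : Term (E ⊗ ∣ P ∣) ∣ Q ∣
    ev = atom 𝕏.ev

    -- Forced by the wish that `ev` be a module map: this amounts to
    -- `ev · (hom-act ⊗ ι) · φ ≋ q · (ι ⊗ ev)`, and `φ` is invertible.
    hom-act : Term (H ⊗ E) E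
    hom-act = atom (curry ⟦ q · (ι ⊗ ev) · φ⁻ ⟧)

    ev-β : ev · (hom-act ⊗ ι) ≋ q · (ι ⊗ ev) · φ⁻
    ev-β = ≋-intro curry-β

    ev-injective : ∀ {X} {f g : Term X E} → ev · (f ⊗ ι) ≋ ev · (g ⊗ ι) → f ≋ g
    ev-injective r = ≋-intro (≈-trans (curry-unique (eq r)) (≈-sym (curry-unique ≈-refl)))

    ev-commutes : ev · (hom-act ⊗ p) · n ≋ q · (ι ⊗ ev)
    ev-commutes = chain
      ( ⟪ ev-β ⟫ · (ι ⊗ p) · n
      ⨾ q · (ι ⊗ ev) · ⟪ φ-isoˡ ⟫
      ⨾ done )

    abstract
      hom-assoc : hom-act · (ι ⊗ hom-act) ≋ hom-act · (∇ ⊗ ι) · α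
      hom-assoc = ev-injective (chain
        ( ⟪ ev-β ⟫ · ((ι ⊗ hom-act) ⊗ ι)
        ⨾ q · (ι ⊗ ev) · ⟪ φ⁻-natural (curry ⟦ q · (ι ⊗ ev) · φ⁻ ⟧) ⟫
        ⨾ q · (ι ⊗ ⟪ ev-β ⟫) · φ⁻
        ⨾ ⟪ assocᵗ Q ⟫ · (ι ⊗ (ι ⊗ ev)) · (ι ⊗ φ⁻) · φ⁻
        ⨾ q · (ι ⊗ ev) · ⟪ φ⁻-μ ⟫⁻
        ⨾ ⟪ ev-β ⟫⁻ · (μ ⊗ ι)
        ⨾ done ))

      hom-unit : hom-act · (u ⊗ ι) ≋ l
      hom-unit = ev-injective (chain
        ( ⟪ ev-β ⟫ · ((u ⊗ ι) ⊗ ι)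
        ⨾ q · (ι ⊗ ev) · ⟪ φ⁻-η ⟫ · (l ⊗ ι)
        ⨾ ⟪ unitᵗ Q ⟫ · l⁻ · ev · (l ⊗ ι)
        ⨾ done ))

    hom-module : Module
    hom-module = record
      { carrier = [ carrier P , carrier Q ]₀
      ; act = ⟦ hom-act ⟧
      ; act-assoc = eq hom-assoc
      ; act-unit = eq hom-unit }

    ev-hom : ModuleHom (tensor hom-module P) Q
    ev-hom = record { hom = 𝕏.ev ; commutes = eq ev-commutes }

    curry-hom : ModuleHom (tensor R P) Q → ModuleHom R hom-module
    curry-hom {R} f = record
      { hom = curry (hom f)
      ; commutes = eq (ev-injective {f = g · actᵗ R} {hom-act · (ι ⊗ g)} (chain
          ( ⟪ β ⟫ · (actᵗ R ⊗ ι)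
          -- `(actᵗ R ⊗ ι) · φ` is the diagonal action on `R ⊗ P`, which `f` respects.
          ⨾ fᵗ · (actᵗ R ⊗ ι) · ⟪ φ-isoʳ ⟫⁻
          ⨾ ⟪ f-commutes ⟫ · φ⁻
          ⨾ q · (ι ⊗ ⟪ β ⟫⁻) · φ⁻
          ⨾ q · (ι ⊗ ev) · ⟪ φ⁻-natural (curry (hom f)) ⟫⁻
          ⨾ ⟪ ev-β ⟫⁻ · ((ι ⊗ g) ⊗ ι)
          ⨾ done ))) }
      where
      fᵗ : Term (∣ R ∣ ⊗ ∣ P ∣) ∣ Q ∣
      fᵗ = atom (hom f)

      g : Term ∣ R ∣ E
      g = atom (curry (hom f))

      β : ev · (g ⊗ ι) ≋ fᵗ
      β = ≋-intro curry-β

      f-commutes : fᵗ · (actᵗ R ⊗ p) · n ≋ q · (ι ⊗ fᵗ)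
      f-commutes = ≋-intro (commutes f)

  tensor-hom : ModuleHom P P′ → ModuleHom Q Q′ → ModuleHom (tensor P Q) (tensor P′ Q′)
  tensor-hom {P} {P′} {Q} {Q′} f g = record
    { hom = hom f ⊗₁ hom g
    ; commutes = eq (chain {f = (homᵗ f ⊗ homᵗ g) · tensor-act P Q} {tensor-act P′ Q′ · (ι ⊗ (homᵗ f ⊗ homᵗ g))}
        ((⟪ commutesᵗ f ⟫ ⊗ ⟪ commutesᵗ g ⟫) · n ⨾ done)) }

  -- The forgetful functor from modules reflects isomorphisms, so the inverse structure maps lift
  -- along with the structure maps.
  inverse-hom : (f : ModuleHom P Q) (g : carrier Q ⇒ carrier P) → g ∘ hom f ≈ id → hom f ∘ g ≈ id → ModuleHom Q P
  inverse-hom {P} {Q} f g gf fg = record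
    { hom = g
    ; commutes = eq (chain {f = gᵗ · actᵗ Q} {actᵗ P · (ι ⊗ gᵗ)}
        ( gᵗ · actᵗ Q · (ι ⊗ ⟪ fgᵗ ⟫⁻)
        ⨾ gᵗ · ⟪ commutesᵗ f ⟫⁻ · (ι ⊗ gᵗ)
        ⨾ ⟪ gfᵗ ⟫ · actᵗ P · (ι ⊗ gᵗ)
        ⨾ done )) }
    where
    gᵗ : Term ∣ Q ∣ ∣ P ∣
    gᵗ = atom g

    gfᵗ : gᵗ · homᵗ f ≋ ι
    gfᵗ = ≋-intro gf

    fgᵗ : homᵗ f · gᵗ ≋ ι
    fgᵗ = ≋-intro fg

  α-hom : ModuleHom (tensor P (tensor Q R)) (tensor (tensor P Q) R)
  α-hom {P} {Q} {R} = record
    { hom = 𝕏.α⇒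
    ; commutes = eq (chain
        {f = α · (actᵗ P ⊗ tensor-act Q R) · n} {((tensor-act P Q ⊗ actᵗ R) · n) · (ι ⊗ α)}
        (((actᵗ P ⊗ actᵗ Q) ⊗ actᵗ R) · ⟪ n-assoc ⟫ ⨾ done)) }

  α⁻-hom : ModuleHom (tensor (tensor P Q) R) (tensor P (tensor Q R))
  α⁻-hom {P} {Q} {R} = inverse-hom (α-hom {P} {Q} {R}) 𝕏.α⇐ 𝕏.α-isoˡ 𝕏.α-isoʳ

  l-hom : ModuleHom (tensor unit-module P) P
  l-hom {P} = record
    { hom = 𝕏.ℓ⇒
    ; commutes = eq (chain {f = l · (nK ⊗ actᵗ P) · n} {actᵗ P · (ι ⊗ l)}
        (actᵗ P · ⟪ n-unitˡ ⟫ ⨾ done)) }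

  l⁻-hom : ModuleHom P (tensor unit-module P)
  l⁻-hom {P} = inverse-hom (l-hom {P}) 𝕏.ℓ⇐ 𝕏.ℓ-isoˡ 𝕏.ℓ-isoʳ

  r-hom : ModuleHom (tensor P unit-module) P
  r-hom {P} = record
    { hom = 𝕏.ρ⇒
    ; commutes = eq (chain {f = r · (actᵗ P ⊗ nK) · n} {actᵗ P · (ι ⊗ r)}
        (actᵗ P · ⟪ n-unitʳ ⟫ ⨾ done)) }

  r⁻-hom : ModuleHom P (tensor P unit-module)
  r⁻-hom {P} = inverse-hom (r-hom {P}) 𝕏.ρ⇐ 𝕏.ρ-isoˡ 𝕏.ρ-isoʳ

  s-hom : ModuleHom (tensor P Q) (tensor Q P)
  s-hom {P} {Q} = record
    { hom = 𝕏.σ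
    ; commutes = eq (chain {f = s · tensor-act P Q} {tensor-act Q P · (ι ⊗ s)}
        ((actᵗ Q ⊗ actᵗ P) · ⟪ n-σ ⟫ ⨾ done)) }

  bang-hom : ModuleHom P Q → ModuleHom (bang-module P) (bang-module Q)
  bang-hom {P} {Q} f = record
    { hom = !₁ (hom f)
    ; commutes = eq (chain {f = ! homᵗ f · bang-act P} {bang-act Q · (ι ⊗ ! homᵗ f)}
        (! ⟪ commutesᵗ f ⟫ · λL ⨾ done)) }

  δ-hom : ModuleHom (bang-module P) (bang-module (bang-module P))
  δ-hom {P} = record
    { hom = 𝕏.δ
    ; commutes = eq (chain {f = δ · bang-act P} {(! bang-act P · λL) · (ι ⊗ δ)}
        (! ! actᵗ P · ⟪ λ-δ ⟫ ⨾ done)) }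

  ε-hom : ModuleHom (bang-module P) P
  ε-hom {P} = record
    { hom = 𝕏.ε
    ; commutes = eq (chain {f = ε · bang-act P} {actᵗ P · (ι ⊗ ε)}
        (actᵗ P · ⟪ λ-ε ⟫ ⨾ done)) }

  m-hom : ModuleHom (tensor (bang-module P) (bang-module Q)) (bang-module (tensor P Q))
  m-hom {P} {Q} = record
    { hom = 𝕏.m
    ; commutes = eq (chain
        {f = m · (bang-act P ⊗ bang-act Q) · n} {(! tensor-act P Q · λL) · (ι ⊗ m)}
        (! (actᵗ P ⊗ actᵗ Q) · ⟪ λ-m ⟫⁻ ⨾ done)) }

  mK-hom : ModuleHom unit-module (bang-module unit-module)
  mK-hom = record
    { hom = 𝕏.mK
    ; commutes = eq (chain {f = mK · nK} {(! nK · λL) · (ι ⊗ mK)} (⟪ λ-mK ⟫⁻ ⨾ done)) }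

  Δ-hom : ModuleHom (bang-module P) (tensor (bang-module P) (bang-module P))
  Δ-hom {P} = record
    { hom = 𝕏.Δ
    ; commutes = eq (chain
        {f = Δ · bang-act P} {((bang-act P ⊗ bang-act P) · n) · (ι ⊗ Δ)}
        ((! actᵗ P ⊗ ! actᵗ P) · ⟪ λ-Δ ⟫ ⨾ done)) }

  e-hom : ModuleHom (bang-module P) unit-module
  e-hom {P} = record
    { hom = 𝕏.e
    ; commutes = eq (chain {f = e · bang-act P} {nK · (ι ⊗ e)} (⟪ λ-e ⟫ ⨾ done)) }

  -- Module maps are equal when their underlying maps are, so once the structure maps are lifted
  -- every law is inherited from `𝕏`.
  MOD-monoidal : SymmetricMonoidal MOD
  MOD-monoidal = record
    { _⊗₀_ = tensor
    ; _⊗₁_ = λ {P} {P′} {Q} {Q′} → tensor-hom {P} {P′} {Q} {Q′}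
    ; ⊗-id = 𝕏.⊗-id
    ; ⊗-∘ = 𝕏.⊗-∘
    ; ⊗-resp-≈ = 𝕏.⊗-resp-≈
    ; K = unit-module
    ; α⇒ = λ {P} {Q} {R} → α-hom {P} {Q} {R}
    ; α⇐ = λ {P} {Q} {R} → α⁻-hom {P} {Q} {R}
    ; α-isoˡ = 𝕏.α-isoˡ
    ; α-isoʳ = 𝕏.α-isoʳ
    ; α-natural = 𝕏.α-natural
    ; ℓ⇒ = λ {P} → l-hom {P}
    ; ℓ⇐ = λ {P} → l⁻-hom {P}
    ; ℓ-isoˡ = 𝕏.ℓ-isoˡ
    ; ℓ-isoʳ = 𝕏.ℓ-isoʳ
    ; ℓ-natural = 𝕏.ℓ-natural
    ; ρ⇒ = λ {P} → r-hom {P}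
    ; ρ⇐ = λ {P} → r⁻-hom {P}
    ; ρ-isoˡ = 𝕏.ρ-isoˡ
    ; ρ-isoʳ = 𝕏.ρ-isoʳ
    ; ρ-natural = 𝕏.ρ-natural
    ; σ = λ {P} {Q} → s-hom {P} {Q}
    ; σ-natural = 𝕏.σ-natural
    ; σ-involutive = 𝕏.σ-involutive
    ; pentagon = 𝕏.pentagon
    ; triangle = 𝕏.triangle
    ; hexagon = 𝕏.hexagon }

  MOD-closed : Closed MOD-monoidal
  MOD-closed = record
    { [_,_]₀ = hom-module
    ; ev = λ {P} {Q} → ev-hom P Q
    ; curry = λ {P} {Q} {R} → curry-hom P Q {R}
    ; curry-β = curry-β
    ; curry-unique = curry-unique }

  MOD-modality : MonoidalCoalgebraModality MOD-monoidal
  MOD-modality = record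
    { !₀ = bang-module
    ; !₁ = λ {P} {Q} → bang-hom {P} {Q}
    ; !-id = 𝕏.!-id
    ; !-∘ = 𝕏.!-∘
    ; !-resp-≈ = 𝕏.!-resp-≈
    ; δ = λ {P} → δ-hom {P}
    ; ε = λ {P} → ε-hom {P}
    ; δ-natural = 𝕏.δ-natural
    ; ε-natural = 𝕏.ε-natural
    ; comonad-assoc = 𝕏.comonad-assoc
    ; comonad-idˡ = 𝕏.comonad-idˡ
    ; comonad-idʳ = 𝕏.comonad-idʳ
    ; m = λ {P} {Q} → m-hom {P} {Q}
    ; mK = mK-hom
    ; m-natural = 𝕏.m-natural
    ; m-assoc = 𝕏.m-assoc
    ; m-unitˡ = 𝕏.m-unitˡ
    ; m-unitʳ = 𝕏.m-unitʳ
    ; m-symmetric = 𝕏.m-symmetric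
    ; δ-m = 𝕏.δ-m
    ; δ-mK = 𝕏.δ-mK
    ; ε-m = 𝕏.ε-m
    ; ε-mK = 𝕏.ε-mK
    ; Δ = λ {P} → Δ-hom {P}
    ; e = λ {P} → e-hom {P}
    ; Δ-natural = 𝕏.Δ-natural
    ; e-natural = 𝕏.e-natural
    ; Δ-coassoc = 𝕏.Δ-coassoc
    ; Δ-counitˡ = 𝕏.Δ-counitˡ
    ; Δ-counitʳ = 𝕏.Δ-counitʳ
    ; Δ-cocomm = 𝕏.Δ-cocomm
    ; δ-Δ = 𝕏.δ-Δ
    ; δ-e = 𝕏.δ-e
    ; Δ-m = 𝕏.Δ-m
    ; e-m = 𝕏.e-m
    ; Δ-mK = 𝕏.Δ-mK
    ; e-mK = 𝕏.e-mK
    ; !Δ-δ = 𝕏.!Δ-δ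
    ; !e-δ = 𝕏.!e-δ }

  MOD-linear : LinearStructure MOD
  MOD-linear = record { monoidal = MOD-monoidal ; closed = MOD-closed ; modality = MOD-modality }

  MOD-standard : HasStandardTensor MOD-linear
  MOD-standard = (λ P Q → refl , ≈-refl) , (λ f g → refl , refl , ≈-refl) , (refl , ≈-refl)

theorem7p7 : ∀ {o h ℓe} (𝕏 : LinearCategory o h ℓe) (Add : AdditiveWithNegatives 𝕏)
    (A : LinearCategory.Obj 𝕏) →
    let open Construction 𝕏 Add A in
    IsMELLLiftingMonad 𝕏 T₀ T₁ μ η n nK λL
    × Σ (LinearStructure MOD) HasStandardTensor
theorem7p7 𝕏 Add A = Lifting.isMELLLiftingMonad 𝕏 Add A , Modules.MOD-linear 𝕏 Add A , Modules.MOD-standard 𝕏 Add A
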